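{- Let $k\ge 1$ and let $\Upsilon$ be a subset of $\mathcal{F}_{2,k}$. Then $$\sum_{n\ge 1}\frac{t^{2n-1}}{(k(2n-1))!}\sum_{F\in\mathcal{F}^{(2),\Upsilon}_{2n-1,k}}x^{\Upsilon\text{ -mch}^{(2)}(F)}=\frac{\sum_{n\ge 1}\frac{(x-1)^{n-1}t^{2n-1}}{(k(2n-1))!}\,full^{\Upsilon}_{2n-1}}{1-\sum_{n\ge 1}\frac{(x-1)^{n-1}t^{2n}}{(2kn)!}\,full^{\Upsilon}_{2n}}.$$
   Context: $\mathcal{F}_{n,k}$ is the set of all fillings $F$ of the $k\times n$ rectangular array ($k$ rows, $n$ columns) with the integers $1,\dots,kn$, each used once, such that the elements in each column increase from bottom to top. For a filling of a $k\times n$ array by distinct positive integers with columns increasing from bottom to top, $\mathrm{red}(F)\in\mathcal{F}_{n,k}$ is obtained by replacing the $i$-th smallest entry by $i$. $F[i,i+1]$ is the $k\times 2$ filling formed by columns $i$ and $i+1$ of $F$. For $\Upsilon\subseteq\mathcal{F}_{2,k}$, $F\in\mathcal{F}_{n,k}$ has an $\Upsilon$-match starting at position $i$ ($1\le i\le n-1$) if $\mathrm{red}(F[i,i+1])\in\Upsilon$; $S^{\Upsilon}(F)$ is the set of all such $i$. $\mathcal{F}^{(2),\Upsilon}_{n,k}$ is the set of $F\in\mathcal{F}_{n,k}$ such that every odd $i$ with $1\le i\le n-1$ belongs to $S^{\Upsilon}(F)$. $\Upsilon\text{ -mch}^{(2)}(F)$ is the number of $i$ such that $2i\in S^{\Upsilon}(F)$.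 $full^{\Upsilon}_n$ is the number of $F\in\mathcal{F}_{n,k}$ with $\Upsilon$-matches starting at every position $1,\dots,n-1$, with $full^{\Upsilon}_1=1$ by convention. The identity is one of formal power series in $t$ with coefficients in $\mathbb{Q}[x]$. -}

module Defs where

open import Algebra.Bundles.Raw using (RawRing)
import Algebra.Definitions.RawSemiring as RawSemiringDefs
open import Data.Bool.Base using (if_then_else_)
open import Data.Fin.Base as Fin using (Fin; inject₁; toℕ)
import Data.Fin.Properties as Fin
open import Data.Integer.Base using (+_)
open import Data.List.Base as List using (List; []; _∷_; length; filter; applyUpTo; upTo; cartesianProductWith)
open import Data.List.Relation.Binary.Permutation.Propositional using (_↭_; ↭-refl; ↭-sym; ↭-trans; prep)
open import Data.List.Relation.Binary.Permutation.Propositional.Properties using (∈-resp-↭; shift; drop-∷; ↭-empty-inv)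
import Data.List.Membership.DecPropositional as DecMembership
open import Data.List.Membership.Propositional.Properties using (∈-∃++)
open import Data.List.Relation.Unary.All as All using (All)
open import Data.List.Relation.Unary.Any using (here)
open import Data.Nat.Base using (ℕ; zero; suc; pred; _+_; _*_; _∸_; _<_; _≡ᵇ_; _!)
open import Data.Nat.Divisibility using (_∣_; _∣?_)
open import Data.Nat.Properties using (_≟_; _≤?_; _<?_; _!≢0)
open import Data.Product.Base using (∃; _×_; _,_)
open import Data.Rational.Base as ℚ using (ℚ; 0ℚ; 1ℚ)
open import Data.Vec.Base as Vec using (Vec; []; _∷_; lookup; concat; toList)
import Data.Vec.Relation.Unary.All as VecAll
open import Data.Vec.Relation.Unary.Linked as Linked using (Linked)
open import Level using (Level; 0ℓ; _⊔_)
open import Relation.Binary.Definitions using () renaming (Decidable to Decidable₂)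
open import Relation.Binary.PropositionalEquality using (_≡_; refl)
open import Relation.Nullary.Decidable using (Dec; yes; no; map′; ¬?; _×-dec_; _→-dec_)
open import Relation.Nullary.Negation using (¬_)
open import Relation.Unary using (Pred; Decidable)

[1…_] : ℕ → List ℕ
[1… n ] = applyUpTo suc n

infix 4 _↭?_

_↭?_ : Decidable₂ (_↭_ {A = ℕ})
[]       ↭? []       = yes ↭-refl
[]       ↭? (y ∷ ys) = no λ p → nope (↭-empty-inv (↭-sym p))
  where
  nope : ¬ (y ∷ ys ≡ [])
  nope ()
(x ∷ xs) ↭? ys with DecMembership._∈?_ _≟_ x ys
... | no x∉ys = no λ p → x∉ys (∈-resp-↭ p (here refl))
... | yes x∈ys with ∈-∃++ x∈ys
...   | us , vs , refl = map′
  (λ p → ↭-trans (prep x p) (↭-sym (shift x us vs)))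
  (λ p → drop-∷ (↭-trans p (shift x us vs)))
  (xs ↭? us List.++ vs)

------------------------------------------------------------------------
-- Fillings

-- An array with n columns and k rows is stored as the vector of its
-- columns, and each column lists its entries from bottom to top.

Array : ℕ → ℕ → Set
Array n k = Vec (Vec ℕ k) n

entries : ∀ {n k} → Array n k → List ℕ
entries F = toList (concat F)

IsFilling : ∀ {n k} → Pred (Array n k) 0ℓ
IsFilling {n} {k} F = (entries F ↭ [1… k * n ]) × VecAll.All (Linked _<_) F

isFilling? : ∀ {n k} → Decidable (IsFilling {n} {k})
isFilling? {n} {k} F =
  (entries F ↭? [1… k * n ]) ×-dec VecAll.all? (Linked.linked? _<?_) F

vectorsOver : ∀ {a} {A : Set a} → List A → (n : ℕ) → List (Vec A n)
vectorsOver as zero    = [] ∷ []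
vectorsOver as (suc n) = cartesianProductWith _∷_ as (vectorsOver as n)

-- Every filling has its entries in [1… k * n ], so it occurs in this
-- list, exactly once.

𝓕 : ∀ n k → List (Array n k)
𝓕 n k = filter isFilling? (vectorsOver (vectorsOver [1… k * n ] k) n)

-- The i-th smallest of distinct entries is the one with exactly i
-- entries less than or equal to it.

red : ∀ {n k} → Array n k → Array n k
red F = Vec.map (Vec.map λ v → length (filter (_≤? v) (entries F))) F

-- The position numbered i in 1, …, n - 1 is represented by the element
-- p of Fin (pred n) with i ≡ suc (toℕ p).

twoColumns : ∀ {n k} → Array n k → Fin (pred n) → Array 2 k
twoColumns {suc n} F p = lookup F (inject₁ p) ∷ lookup F (Fin.suc p) ∷ []

module _ {k : ℕ} {ℓ : Level} where

  MatchAt : ∀ {n} → Pred (Array 2 k) ℓ → Array n k → Pred ℕ ℓ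
  MatchAt {n} Υ F i =
    ∃ λ (p : Fin (pred n)) → i ≡ suc (toℕ p) × Υ (red (twoColumns F p))

  MatchesAtAll : ∀ {n} → Pred (Array 2 k) ℓ → Pred (Array n k) ℓ
  MatchesAtAll {n} Υ F = All (MatchAt Υ F) [1… n ∸ 1 ]

  MatchesAtOdd : ∀ {n} → Pred (Array 2 k) ℓ → Pred (Array n k) ℓ
  MatchesAtOdd {n} Υ F = All (λ i → ¬ 2 ∣ i → MatchAt Υ F i) [1… n ∸ 1 ]

  module _ {Υ : Pred (Array 2 k) ℓ} (Υ? : Decidable Υ) where

    matchAt? : ∀ {n} (F : Array n k) → Decidable (MatchAt Υ F)
    matchAt? F i =
      Fin.any? λ p → i ≟ suc (toℕ p) ×-dec Υ? (red (twoColumns F p))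

    matchesAtAll? : ∀ {n} → Decidable (MatchesAtAll {n} Υ)
    matchesAtAll? {n} F = All.all? (matchAt? F) [1… n ∸ 1 ]

    matchesAtOdd? : ∀ {n} → Decidable (MatchesAtOdd {n} Υ)
    matchesAtOdd? {n} F =
      All.all? (λ i → ¬? (2 ∣? i) →-dec matchAt? F i) [1… n ∸ 1 ]

    𝓕⁽²⁾ : ∀ n → List (Array n k)
    𝓕⁽²⁾ n = filter matchesAtOdd? (𝓕 n k)

    -- A match at 2 * i forces i ≤ n, so no i is missed.

    mch⁽²⁾ : ∀ {n} → Array n k → ℕ
    mch⁽²⁾ {n} F = length (filter (λ i → matchAt? F (2 * i)) [1… n ])

    full : ℕ → ℕ
    full n = if n ≡ᵇ 1 then 1 else length (filter matchesAtAll? (𝓕 n k))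

------------------------------------------------------------------------
-- Formal power series in t

module Series {c ℓ} (R : RawRing c ℓ) where

  private module R = RawRing R

  infix  8 -_
  infix  6 _·t^_
  infixl 7 _*ₛ_
  infixl 6 _+ₛ_ _-ₛ_
  infix  5 ∑ₙ≥₁_
  infix  5 ∑
  infix  4 _≈ₛ_ _≈ₛ_÷_

  ∑ : ∀ {a} {A : Set a} → List A → (A → R.Carrier) → R.Carrier
  ∑ as f = List.foldr (λ a s → f a R.+ s) R.0# as

  syntax ∑ as (λ a → e) = ∑[ a ∈ as ] e

  Series : Set c
  Series = ℕ → R.Carrier

  _≈ₛ_ : Series → Series → Set ℓ
  f ≈ₛ g = ∀ N → f N R.≈ g N

  _·t^_ : R.Carrier → ℕ → Series
  (r ·t^ e) N = if e ≡ᵇ N then r else R.0#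

  1ₛ : Series
  1ₛ = R.1# ·t^ 0

  _+ₛ_ : Series → Series → Series
  (f +ₛ g) N = f N R.+ g N

  -_ : Series → Series
  (- f) N = R.- f N

  _-ₛ_ : Series → Series → Series
  f -ₛ g = f +ₛ - g

  _*ₛ_ : Series → Series → Series
  (f *ₛ g) N = ∑[ i ∈ upTo (suc N) ] f i R.* g (N ∸ i)

  -- The sum of a sequence f 1, f 2, … of series, for sequences such
  -- that f n is divisible by t ^ n: under this condition the terms with
  -- n > N do not contribute to the coefficient of t ^ N.

  ∑ₙ≥₁_ : (ℕ → Series) → Series
  (∑ₙ≥₁ f) N = ∑[ n ∈ [1… N ] ] f n N

  -- q ≈ₛ f ÷ g says that g is invertible and that q is f times the
  -- inverse of g.

  _≈ₛ_÷_ : Series → Series → Series → Set (c ⊔ ℓ)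
  q ≈ₛ f ÷ g = ∃ λ g⁻¹ → (g *ₛ g⁻¹ ≈ₛ 1ₛ) × (q ≈ₛ f *ₛ g⁻¹)

------------------------------------------------------------------------
-- The polynomial ring ℚ[x]

-- Lists of coefficients, constant coefficient first; trailing zeros are
-- allowed, hence the setoid equality.

Poly : Set
Poly = List ℚ

coeff : Poly → ℕ → ℚ
coeff []      _       = 0ℚ
coeff (a ∷ p) zero    = a
coeff (a ∷ p) (suc i) = coeff p i

infix  8 -ₚ_
infixl 7 _*ₚ_
infixl 6 _+ₚ_ _-ₚ_
infix  4 _≈ₚ_

_≈ₚ_ : Poly → Poly → Set
p ≈ₚ q = ∀ i → coeff p i ≡ coeff q i

const : ℚ → Poly
const a = a ∷ []

x : Poly
x = 0ℚ ∷ 1ℚ ∷ []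

1ₚ : Poly
1ₚ = const 1ℚ

_+ₚ_ : Poly → Poly → Poly
[]      +ₚ q       = q
(a ∷ p) +ₚ []      = a ∷ p
(a ∷ p) +ₚ (b ∷ q) = (a ℚ.+ b) ∷ (p +ₚ q)

-ₚ_ : Poly → Poly
-ₚ p = List.map ℚ.-_ p

_-ₚ_ : Poly → Poly → Poly
p -ₚ q = p +ₚ -ₚ q

_*ₚ_ : Poly → Poly → Poly
[]      *ₚ q = []
(a ∷ p) *ₚ q = List.map (a ℚ.*_) q +ₚ (0ℚ ∷ p *ₚ q)

ℚ[x] : RawRing 0ℓ 0ℓ
ℚ[x] = record
  { Carrier = Poly
  ; _≈_     = _≈ₚ_
  ; _+_     = _+ₚ_
  ; _*_     = _*ₚ_
  ; -_      = -ₚ_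
  ; 0#      = []
  ; 1#      = 1ₚ
  }

open RawSemiringDefs (RawRing.rawSemiring ℚ[x]) public
  using () renaming (_^_ to _^ₚ_)

1/[_!] : ℕ → Poly
1/[ m !] = const ((+ 1 ℚ./ m !) {{m !≢0}})

fromℕ : ℕ → Poly
fromℕ m = const (+ m ℚ./ 1)

open Series ℚ[x] public

module Submission where

-- Write y = x - 1, and let a block be a filling with a match at every
-- position.  Since x ^ b = 1 + y b for b = 0, 1, the weight x ^ mch of a
-- filling F with 2 n + 1 columns and a match at every odd position can be
-- expanded along the even positions 2, 4, …: at each of them take the
-- summand y b as long as possible, and stop at the first position 2 i + 2
-- at which the summand 1 is taken.  Then the first 2 i + 2 columns of F
-- form a block, weighted by y ^ i, nothing is required at position
-- 2 i + 2, and the remaining columns form an array of odd length that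
-- still carries its full weight.  If the summand 1 is never taken, F
-- itself is a block, weighted by y ^ n (oddWeight-expand).
--
-- Summation over F turns this into a recurrence.  A filling of a
-- juxtaposition of m and n columns consists of a choice of the k m
-- entries on the left, a filling of the left part and a filling of the
-- right part (𝓕-over-++).  Weights that depend on the relative order of
-- the entries only are insensitive to which entries were chosen
-- (∑-𝓕-over), and the number of choices is a binomial coefficient.  So
-- after division by factorials the sum over fillings is multiplicative
-- (∑-𝓕-++-normalized), and with p n, h n and e n the coefficients of
-- t ^ (2 n - 1), t ^ (2 n - 1) and t ^ (2 n) in the three series of the
-- theorem, the expansion becomes
--
--   p (n + 1) = h (n + 1) + ∑ e (i + 1) p (n - i)    (0 ≤ i < n),
--
-- see oddTerm-recurrence.  For the series P, H and E this says that
-- P = H + E P, and hence P = H / (1 - E) (fixedPoint⇒÷).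
--
-- The argument is carried out over an arbitrary commutative ring.  The
-- ring laws of ℚ[x] come from those of formal power series over ℚ, in
-- which polynomials embed by their coefficients.

open import Defs hiding (∑; _≈ₛ_; 1ₛ; -_; _+ₛ_; _-ₛ_; _*ₛ_; _·t^_; ∑ₙ≥₁_; _≈ₛ_÷_)
open import Algebra.Bundles using (CommutativeRing)
open import Algebra.Bundles.Raw using (RawRing)
import Algebra.Definitions.RawSemiring as RawSemiringDefs
open import Data.Bool.Base using (Bool; true; false; _∧_; if_then_else_)
import Data.Fin.Base as Fin
open import Data.Integer.Base as ℤ using (+_)
import Data.Integer.Properties as ℤ
open import Data.List.Base as List
  using (List; []; _∷_; map; concat; filter; length; applyUpTo; upTo; cartesianProductWith)
open import Data.List.Membership.Propositional using (_∈_)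
open import Data.List.Membership.Propositional.Properties
  using (∈-∃++; ∈-++⁺ˡ; ∈-++⁺ʳ; ∈-++⁻; ∈-map⁺; ∈-map⁻; ∈-filter⁺; ∈-filter⁻; ∈-concat⁺′; ∈-concat⁻′;
         ∈-cartesianProductWith⁺; ∈-cartesianProductWith⁻; ∈-applyUpTo⁺; ∈-applyUpTo⁻; ∈-upTo⁻)
open import Data.List.Membership.Propositional.Properties.WithK using (unique∧set⇒bag)
import Data.List.Properties as List
open import Data.List.Relation.Binary.BagAndSetEquality using (∼bag⇒↭)
open import Data.List.Relation.Binary.Permutation.Propositional as ↭ using (_↭_; ↭-refl; ↭-sym; ↭-trans; prep)
open import Data.List.Relation.Binary.Permutation.Propositional.Properties
  using (∈-resp-↭; shift; drop-∷; ↭-empty-inv; ↭-length; ↭-map-inv; map⁺; ++⁺; ++⁺ˡ; ++⁺ʳ)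
open import Data.List.Relation.Binary.Sublist.Propositional
  using ([]; _∷ʳ_; _∷_; ⊆-refl; minimum) renaming (_⊆_ to _⊑_)
open import Data.List.Relation.Binary.Sublist.Propositional.Properties using (All-resp-⊆; Any-resp-⊆)
open import Data.List.Relation.Unary.All as All using (All; []; _∷_)
import Data.List.Relation.Unary.All.Properties as All
open import Data.List.Relation.Unary.AllPairs as AllPairs using (AllPairs; []; _∷_)
import Data.List.Relation.Unary.AllPairs.Properties as AllPairs
open import Data.List.Relation.Unary.Any using (here; there)
open import Data.List.Relation.Unary.Unique.Propositional using (Unique)
import Data.List.Relation.Unary.Unique.Propositional.Properties as Unique
open import Data.Nat.Base using (ℕ; zero; suc; _+_; _*_; _∸_; _/_; _!; _≤_; _<_; z≤n; s≤s; NonZero)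
open import Data.Nat.Combinatorics using (_C_; nCk+nC[k+1]≡[n+1]C[k+1]; k![n∸k]!∣n!)
open import Data.Nat.Combinatorics.Specification using (nCk≡n!/k![n-k]!)
open import Data.Nat.Divisibility using (_∣_; ∣m+n∣m⇒∣n; ∣m∣n⇒∣m+n; ∣-refl; ∣⇒≤)
open import Data.Nat.DivMod using (m/n*n≡m)
open import Data.Nat.Properties as ℕ using (_!≢0)
open import Data.Product.Base using (∃; _×_; _,_; proj₁; proj₂; map₁; map₂)
open import Data.Rational.Base as ℚ using (ℚ; 0ℚ; 1ℚ)
import Data.Rational.Properties as ℚ
open import Data.Rational.Unnormalised.Base as ℚᵘ using (mkℚᵘ; *≡*)
import Data.Rational.Unnormalised.Properties as ℚᵘ
open import Data.Sum.Base using (_⊎_; inj₁; inj₂)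
open import Data.Vec.Base as Vec using (Vec; []; _∷_; toList)
import Data.Vec.Properties as Vec
import Data.Vec.Relation.Unary.All as VecAll
import Data.Vec.Relation.Unary.All.Properties as VecAll
open import Data.Vec.Relation.Unary.Linked as Linked using (Linked)
import Data.Vec.Relation.Unary.Linked.Properties as Linked
open import Function.Base using (_∘_; id)
open import Function.Bundles using (_⇔_; mk⇔; Equivalence)
open import Function.Construct.Composition using (_⇔-∘_)
open import Level using (Level; 0ℓ)
open import Relation.Binary.Definitions using (tri<; tri≈; tri>)
open import Relation.Binary.PropositionalEquality as ≡
  using (_≡_; _≢_; refl; sym; trans; cong; cong₂; subst; subst₂)
open import Relation.Nullary.Decidable using (does; _×-dec_; does-⇔; dec-true; dec-false)
open import Relation.Nullary.Negation using (¬_; contradiction)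
open import Relation.Unary using (Pred; Decidable; _⊆_)

private variable
  a b : Level
  A : Set a
  B : Set b

------------------------------------------------------------------------
-- Finite sums in a commutative ring

module FiniteSums {c ℓ} (R : CommutativeRing c ℓ) where

  open CommutativeRing R renaming (refl to ≈-refl; sym to ≈-sym; trans to ≈-trans;
    _+_ to infixl 6 _⊕_; _*_ to infixl 7 _⊛_; _-_ to infixl 6 _⊖_; -_ to neg) hiding (zero)
  open Series rawRing using (∑)
  open import Algebra.Solver.Ring.NaturalCoefficients.Default commutativeSemiring
    using (solve; _:=_; _:+_; _:*_)
  open import Relation.Binary.Reasoning.Setoid setoid

  ∑-cong : ∀ (as : List A) {f g} → (∀ {a} → a ∈ as → f a ≈ g a) → ∑ as f ≈ ∑ as g
  ∑-cong []       f≈g = ≈-refl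
  ∑-cong (a ∷ as) f≈g = +-cong (f≈g (here refl)) (∑-cong as (f≈g ∘ there))

  ∑-zero : ∀ (as : List A) {f} → (∀ {a} → a ∈ as → f a ≈ 0#) → ∑ as f ≈ 0#
  ∑-zero []       f≈0 = ≈-refl
  ∑-zero (a ∷ as) f≈0 =
    ≈-trans (+-cong (f≈0 (here refl)) (∑-zero as (f≈0 ∘ there))) (+-identityˡ 0#)

  ∑-+ : ∀ (as : List A) f g → ∑ as (λ a → f a ⊕ g a) ≈ ∑ as f ⊕ ∑ as g
  ∑-+ []       f g = ≈-sym (+-identityˡ 0#)
  ∑-+ (a ∷ as) f g = ≈-trans (+-congˡ (∑-+ as f g))
    (solve 4 (λ u v s t → (u :+ v) :+ (s :+ t) := (u :+ s) :+ (v :+ t)) ≈-refl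
      (f a) (g a) (∑ as f) (∑ as g))

  *-∑ : ∀ r (as : List A) f → r ⊛ ∑ as f ≈ ∑ as (λ a → r ⊛ f a)
  *-∑ r []       f = zeroʳ r
  *-∑ r (a ∷ as) f = ≈-trans (distribˡ r (f a) (∑ as f)) (+-congˡ (*-∑ r as f))

  ∑-* : ∀ (as : List A) f r → ∑ as f ⊛ r ≈ ∑ as (λ a → f a ⊛ r)
  ∑-* as f r = ≈-trans (*-comm (∑ as f) r)
    (≈-trans (*-∑ r as f) (∑-cong as (λ {a} _ → *-comm r (f a))))

  ∑-++ : ∀ (as bs : List A) f → ∑ (as List.++ bs) f ≈ ∑ as f ⊕ ∑ bs f
  ∑-++ []       bs f = ≈-sym (+-identityˡ (∑ bs f))
  ∑-++ (a ∷ as) bs f = ≈-trans (+-congˡ (∑-++ as bs f)) (≈-sym (+-assoc (f a) (∑ as f) (∑ bs f)))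

  ∑-map : ∀ (h : A → B) as f → ∑ (map h as) f ≡ ∑ as (f ∘ h)
  ∑-map h []       f = refl
  ∑-map h (a ∷ as) f = cong (f (h a) ⊕_) (∑-map h as f)

  ∑-concat-map : ∀ (h : A → List B) as f → ∑ (concat (map h as)) f ≈ ∑ as (λ a → ∑ (h a) f)
  ∑-concat-map h []       f = ≈-refl
  ∑-concat-map h (a ∷ as) f =
    ≈-trans (∑-++ (h a) (concat (map h as)) f) (+-congˡ (∑-concat-map h as f))

  ∑-cartesianProductWith : ∀ {c} {C : Set c} (h : A → B → C) as bs f →
    ∑ (cartesianProductWith h as bs) f ≈ ∑ as (λ a → ∑ bs (λ b → f (h a b)))
  ∑-cartesianProductWith h []       bs f = ≈-refl
  ∑-cartesianProductWith h (a ∷ as) bs f = begin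
    ∑ (map (h a) bs List.++ cartesianProductWith h as bs) f
      ≈⟨ ∑-++ (map (h a) bs) _ f ⟩
    ∑ (map (h a) bs) f ⊕ ∑ (cartesianProductWith h as bs) f
      ≈⟨ +-cong (reflexive (∑-map (h a) bs f)) (∑-cartesianProductWith h as bs f) ⟩
    ∑ (a ∷ as) (λ a → ∑ bs (λ b → f (h a b))) ∎

  ∑-swap : ∀ (as : List A) (bs : List B) (f : A → B → Carrier) →
    ∑ as (λ a → ∑ bs (f a)) ≈ ∑ bs (λ b → ∑ as (λ a → f a b))
  ∑-swap []       bs f = ≈-sym (∑-zero bs (λ _ → ≈-refl))
  ∑-swap (a ∷ as) bs f =
    ≈-trans (+-congˡ (∑-swap as bs f)) (≈-sym (∑-+ bs (f a) (λ b → ∑ as (λ a → f a b))))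

  ∑-↭ : ∀ {as bs : List A} f → as ↭ bs → ∑ as f ≈ ∑ bs f
  ∑-↭ f ↭.refl          = ≈-refl
  ∑-↭ f (↭.prep a p)    = +-congˡ (∑-↭ f p)
  ∑-↭ f (↭.swap {xs} {ys} a b p) = ≈-trans (+-congˡ (+-congˡ (∑-↭ f p)))
    (solve 3 (λ u v s → u :+ (v :+ s) := v :+ (u :+ s)) ≈-refl (f a) (f b) (∑ ys f))
  ∑-↭ f (↭.trans p q)   = ≈-trans (∑-↭ f p) (∑-↭ f q)

  ∑-filter : ∀ {p} {P : Pred A p} (P? : Decidable P) as f →
    ∑ (filter P? as) f ≈ ∑ as (λ a → if does (P? a) then f a else 0#)
  ∑-filter P? []       f = ≈-refl
  ∑-filter P? (a ∷ as) f with does (P? a)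
  ... | true  = +-congˡ (∑-filter P? as f)
  ... | false = ≈-trans (∑-filter P? as f) (≈-sym (+-identityˡ _))

  ∑-applyUpTo : ∀ (h : ℕ → A) n f → ∑ (applyUpTo h n) f ≡ ∑ (upTo n) (f ∘ h)
  ∑-applyUpTo h n f = trans (reindex h n f) (sym (reindex id n (f ∘ h)))
    where
    below : ℕ → (ℕ → Carrier) → Carrier
    below zero    f = 0#
    below (suc n) f = f 0 ⊕ below n (f ∘ suc)

    reindex : ∀ {a} {A : Set a} (h : ℕ → A) n f → ∑ (applyUpTo h n) f ≡ below n (f ∘ h)
    reindex h zero    f = refl
    reindex h (suc n) f = cong (f (h 0) ⊕_) (reindex (h ∘ suc) n f)

  ∑-upTo-suc : ∀ n f → ∑ (upTo (suc n)) f ≡ f 0 ⊕ ∑ (upTo n) (f ∘ suc)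
  ∑-upTo-suc n f = cong (f 0 ⊕_) (∑-applyUpTo suc n f)

------------------------------------------------------------------------
-- The ring of formal power series

module SeriesRing {c ℓ} (R : CommutativeRing c ℓ) where

  open CommutativeRing R renaming (refl to ≈-refl; sym to ≈-sym; trans to ≈-trans;
    _+_ to infixl 6 _⊕_; _*_ to infixl 7 _⊛_; _-_ to infixl 6 _⊖_; -_ to neg) hiding (zero)
  open Series rawRing renaming (Series to PowerSeries)
  open FiniteSums R
  open import Algebra.Solver.Ring.NaturalCoefficients.Default commutativeSemiring
    using (solve; _:=_; _:+_; _:*_)
  open import Algebra.Properties.Ring ring using (-1*x≈-x)
  open import Relation.Binary.Reasoning.Setoid setoid

  -- A series is its constant coefficient plus t times its tail f ∘ suc;
  -- the ring laws follow by induction on the exponent from the next two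
  -- equations.
  *ₛ-0 : ∀ f g → (f *ₛ g) 0 ≈ f 0 ⊛ g 0
  *ₛ-0 f g = +-identityʳ (f 0 ⊛ g 0)

  *ₛ-suc : ∀ f g N → (f *ₛ g) (suc N) ≡ f 0 ⊛ g (suc N) ⊕ ((f ∘ suc) *ₛ g) N
  *ₛ-suc f g N = ∑-upTo-suc (suc N) (λ i → f i ⊛ g (suc N ∸ i))

  *ₛ-sucᵉ : ∀ f g N → (f *ₛ g) (suc N) ≈ f 0 ⊛ g (suc N) ⊕ ((f ∘ suc) *ₛ g) N
  *ₛ-sucᵉ f g N = reflexive (*ₛ-suc f g N)

  -- Only the coefficients up to N enter the coefficient of t ^ N.
  *ₛ-cong-≤ : ∀ {f f′ g g′} N → (∀ {i} → i ≤ N → f i ≈ f′ i) → (∀ {i} → i ≤ N → g i ≈ g′ i) →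
    (f *ₛ g) N ≈ (f′ *ₛ g′) N
  *ₛ-cong-≤ {f} {f′} {g} {g′} zero f≈ g≈ = begin
    (f *ₛ g) 0    ≈⟨ *ₛ-0 f g ⟩
    f 0 ⊛ g 0     ≈⟨ *-cong (f≈ z≤n) (g≈ z≤n) ⟩
    f′ 0 ⊛ g′ 0   ≈⟨ *ₛ-0 f′ g′ ⟨
    (f′ *ₛ g′) 0  ∎
  *ₛ-cong-≤ {f} {f′} {g} {g′} (suc N) f≈ g≈ = begin
    (f *ₛ g) (suc N)                            ≈⟨ *ₛ-sucᵉ f g N ⟩
    f 0 ⊛ g (suc N) ⊕ ((f ∘ suc) *ₛ g) N
      ≈⟨ +-cong (*-cong (f≈ z≤n) (g≈ ℕ.≤-refl)) (*ₛ-cong-≤ N (f≈ ∘ s≤s) (g≈ ∘ ℕ.m≤n⇒m≤1+n)) ⟩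
    f′ 0 ⊛ g′ (suc N) ⊕ ((f′ ∘ suc) *ₛ g′) N    ≈⟨ *ₛ-sucᵉ f′ g′ N ⟨
    (f′ *ₛ g′) (suc N)                          ∎

  *ₛ-cong : ∀ {f f′ g g′} → f ≈ₛ f′ → g ≈ₛ g′ → f *ₛ g ≈ₛ f′ *ₛ g′
  *ₛ-cong {f} {f′} {g} {g′} f≈ g≈ N =
    *ₛ-cong-≤ {f} {f′} {g} {g′} N (λ {i} _ → f≈ i) (λ {i} _ → g≈ i)

  *ₛ-distribʳ : ∀ h f g → (f +ₛ g) *ₛ h ≈ₛ f *ₛ h +ₛ g *ₛ h
  *ₛ-distribʳ h f g N = ≈-trans
    (∑-cong (upTo (suc N)) (λ {i} _ → distribʳ (h (N ∸ i)) (f i) (g i)))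
    (∑-+ (upTo (suc N)) (λ i → f i ⊛ h (N ∸ i)) (λ i → g i ⊛ h (N ∸ i)))

  *ₛ-scalar : ∀ r f g N → ((λ i → r ⊛ f i) *ₛ g) N ≈ r ⊛ (f *ₛ g) N
  *ₛ-scalar r f g N = ≈-trans
    (∑-cong (upTo (suc N)) (λ {i} _ → *-assoc r (f i) (g (N ∸ i))))
    (≈-sym (*-∑ r (upTo (suc N)) (λ i → f i ⊛ g (N ∸ i))))

  *ₛ-assoc : ∀ f g h → (f *ₛ g) *ₛ h ≈ₛ f *ₛ (g *ₛ h)
  *ₛ-assoc f g h zero = begin
    ((f *ₛ g) *ₛ h) 0   ≈⟨ *ₛ-0 (f *ₛ g) h ⟩
    (f *ₛ g) 0 ⊛ h 0    ≈⟨ *-congʳ (*ₛ-0 f g) ⟩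
    f 0 ⊛ g 0 ⊛ h 0     ≈⟨ *-assoc (f 0) (g 0) (h 0) ⟩
    f 0 ⊛ (g 0 ⊛ h 0)   ≈⟨ *-congˡ (*ₛ-0 g h) ⟨
    f 0 ⊛ (g *ₛ h) 0    ≈⟨ *ₛ-0 f (g *ₛ h) ⟨
    (f *ₛ (g *ₛ h)) 0   ∎
  *ₛ-assoc f g h (suc N) = begin
    ((f *ₛ g) *ₛ h) (suc N)
      ≈⟨ *ₛ-sucᵉ (f *ₛ g) h N ⟩
    (f *ₛ g) 0 ⊛ h (suc N) ⊕ (((f *ₛ g) ∘ suc) *ₛ h) N
      ≈⟨ +-cong (*-congʳ (*ₛ-0 f g)) (*ₛ-cong {g = h} (*ₛ-sucᵉ f g) (λ _ → ≈-refl) N) ⟩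
    f 0 ⊛ g 0 ⊛ h (suc N) ⊕ (((λ i → f 0 ⊛ g (suc i)) +ₛ (f′ *ₛ g)) *ₛ h) N
      ≈⟨ +-congˡ (*ₛ-distribʳ h (λ i → f 0 ⊛ g (suc i)) (f′ *ₛ g) N) ⟩
    f 0 ⊛ g 0 ⊛ h (suc N) ⊕ (((λ i → f 0 ⊛ g (suc i)) *ₛ h) N ⊕ ((f′ *ₛ g) *ₛ h) N)
      ≈⟨ +-congˡ (+-cong (*ₛ-scalar (f 0) (g ∘ suc) h N) (*ₛ-assoc f′ g h N)) ⟩
    f 0 ⊛ g 0 ⊛ h (suc N) ⊕ (f 0 ⊛ ((g ∘ suc) *ₛ h) N ⊕ (f′ *ₛ (g *ₛ h)) N)
      ≈⟨ solve 5 (λ a b c d e → a :* b :* c :+ (a :* d :+ e) := a :* (b :* c :+ d) :+ e) ≈-refl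
           (f 0) (g 0) (h (suc N)) (((g ∘ suc) *ₛ h) N) ((f′ *ₛ (g *ₛ h)) N) ⟩
    f 0 ⊛ (g 0 ⊛ h (suc N) ⊕ ((g ∘ suc) *ₛ h) N) ⊕ (f′ *ₛ (g *ₛ h)) N
      ≈⟨ +-congʳ (*-congˡ (*ₛ-sucᵉ g h N)) ⟨
    f 0 ⊛ (g *ₛ h) (suc N) ⊕ (f′ *ₛ (g *ₛ h)) N
      ≈⟨ *ₛ-sucᵉ f (g *ₛ h) N ⟨
    (f *ₛ (g *ₛ h)) (suc N) ∎
    where f′ = f ∘ suc

  -- The mirror image of *ₛ-suc, which splits off the last summand.
  *ₛ-sucʳ : ∀ f g N → (f *ₛ g) (suc N) ≈ f (suc N) ⊛ g 0 ⊕ (f *ₛ (g ∘ suc)) N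
  *ₛ-sucʳ f g zero = begin
    (f *ₛ g) 1                              ≈⟨ *ₛ-sucᵉ f g 0 ⟩
    f 0 ⊛ g 1 ⊕ ((f ∘ suc) *ₛ g) 0          ≈⟨ +-comm _ _ ⟩
    ((f ∘ suc) *ₛ g) 0 ⊕ f 0 ⊛ g 1          ≈⟨ +-cong (*ₛ-0 (f ∘ suc) g) (≈-sym (*ₛ-0 f (g ∘ suc))) ⟩
    f 1 ⊛ g 0 ⊕ (f *ₛ (g ∘ suc)) 0          ∎
  *ₛ-sucʳ f g (suc N) = begin
    (f *ₛ g) (suc (suc N))
      ≈⟨ *ₛ-sucᵉ f g (suc N) ⟩
    f 0 ⊛ g (suc (suc N)) ⊕ (f′ *ₛ g) (suc N)
      ≈⟨ +-congˡ (*ₛ-sucʳ f′ g N) ⟩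
    f 0 ⊛ g (suc (suc N)) ⊕ (f (suc (suc N)) ⊛ g 0 ⊕ (f′ *ₛ (g ∘ suc)) N)
      ≈⟨ solve 3 (λ a b c → a :+ (b :+ c) := b :+ (a :+ c)) ≈-refl _ _ _ ⟩
    f (suc (suc N)) ⊛ g 0 ⊕ (f 0 ⊛ g (suc (suc N)) ⊕ (f′ *ₛ (g ∘ suc)) N)
      ≈⟨ +-congˡ (*ₛ-sucᵉ f (g ∘ suc) N) ⟨
    f (suc (suc N)) ⊛ g 0 ⊕ (f *ₛ (g ∘ suc)) (suc N) ∎
    where f′ = f ∘ suc

  *ₛ-comm : ∀ f g → f *ₛ g ≈ₛ g *ₛ f
  *ₛ-comm f g zero = ≈-trans (*ₛ-0 f g) (≈-trans (*-comm (f 0) (g 0)) (≈-sym (*ₛ-0 g f)))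
  *ₛ-comm f g (suc N) = begin
    (f *ₛ g) (suc N)                        ≈⟨ *ₛ-sucᵉ f g N ⟩
    f 0 ⊛ g (suc N) ⊕ ((f ∘ suc) *ₛ g) N    ≈⟨ +-cong (*-comm _ _) (*ₛ-comm (f ∘ suc) g N) ⟩
    g (suc N) ⊛ f 0 ⊕ (g *ₛ (f ∘ suc)) N    ≈⟨ *ₛ-sucʳ g f N ⟨
    (g *ₛ f) (suc N)                        ∎

  *ₛ-zeroˡ : ∀ g N → ((λ _ → 0#) *ₛ g) N ≈ 0#
  *ₛ-zeroˡ g N = ∑-zero (upTo (suc N)) (λ {i} _ → zeroˡ (g (N ∸ i)))

  *ₛ-identityˡ : ∀ g → 1ₛ *ₛ g ≈ₛ g
  *ₛ-identityˡ g zero    = ≈-trans (*ₛ-0 1ₛ g) (*-identityˡ (g 0))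
  *ₛ-identityˡ g (suc N) = begin
    (1ₛ *ₛ g) (suc N)                             ≈⟨ *ₛ-sucᵉ 1ₛ g N ⟩
    1# ⊛ g (suc N) ⊕ ((λ _ → 0#) *ₛ g) N          ≈⟨ +-cong (*-identityˡ _) (*ₛ-zeroˡ g N) ⟩
    g (suc N) ⊕ 0#                                ≈⟨ +-identityʳ _ ⟩
    g (suc N)                                     ∎

  *ₛ-negˡ : ∀ f g → (- f) *ₛ g ≈ₛ - (f *ₛ g)
  *ₛ-negˡ f g N = begin
    ((- f) *ₛ g) N                     ≈⟨ *ₛ-cong {g = g} (λ i → -1*x≈-x (f i)) (λ _ → ≈-refl) N ⟨
    ((λ i → neg 1# ⊛ f i) *ₛ g) N      ≈⟨ *ₛ-scalar (neg 1#) f g N ⟩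
    neg 1# ⊛ (f *ₛ g) N                ≈⟨ -1*x≈-x _ ⟩
    (- (f *ₛ g)) N                     ∎

  module _ (e : PowerSeries) (e₀ : e 0 ≈ 0#) where

    private
      -- Successive approximations of 1 / (1 - e): the n-th one is correct
      -- up to the coefficient of t ^ n.
      approx : ℕ → PowerSeries
      approx zero            = 1ₛ
      approx (suc n) zero    = 1#
      approx (suc n) (suc N) = ((e ∘ suc) *ₛ approx n) N

      approx-stable : ∀ {m n N} → N ≤ m → N ≤ n → approx m N ≈ approx n N
      approx-stable {zero}  {zero}  z≤n z≤n = ≈-refl
      approx-stable {zero}  {suc n} z≤n z≤n = ≈-refl
      approx-stable {suc m} {zero}  z≤n z≤n = ≈-refl
      approx-stable {suc m} {suc n} z≤n z≤n = ≈-refl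
      approx-stable {suc m} {suc n} (s≤s N≤m) (s≤s N≤n) =
        *ₛ-cong-≤ _ (λ _ → ≈-refl) (λ i≤N → approx-stable (ℕ.≤-trans i≤N N≤m) (ℕ.≤-trans i≤N N≤n))

    -- The series 1 / (1 - e) = 1 + e + e ^ 2 + ….
    geometric : PowerSeries
    geometric N = approx N N

    geometric-rec : geometric ≈ₛ 1ₛ +ₛ e *ₛ geometric
    geometric-rec zero    = ≈-sym (begin
      1# ⊕ (e *ₛ geometric) 0   ≈⟨ +-congˡ (*ₛ-0 e geometric) ⟩
      1# ⊕ e 0 ⊛ 1#             ≈⟨ +-congˡ (≈-trans (*-identityʳ (e 0)) e₀) ⟩
      1# ⊕ 0#                   ≈⟨ +-identityʳ 1# ⟩
      1#                        ∎)
    geometric-rec (suc N) = ≈-sym (begin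
      0# ⊕ (e *ₛ geometric) (suc N)   ≈⟨ +-identityˡ _ ⟩
      (e *ₛ geometric) (suc N)        ≈⟨ *ₛ-sucᵉ e geometric N ⟩
      e 0 ⊛ geometric (suc N) ⊕ ((e ∘ suc) *ₛ geometric) N
        ≈⟨ +-congʳ (≈-trans (*-congʳ e₀) (zeroˡ _)) ⟩
      0# ⊕ ((e ∘ suc) *ₛ geometric) N ≈⟨ +-identityˡ _ ⟩
      ((e ∘ suc) *ₛ geometric) N
        ≈⟨ *ₛ-cong-≤ N (λ _ → ≈-refl) (λ i≤N → approx-stable ℕ.≤-refl i≤N) ⟩
      geometric (suc N)               ∎)

    -- The only solution f of f = h + e f is h / (1 - e).
    fixedPoint⇒÷ : ∀ {f h} → f ≈ₛ h +ₛ e *ₛ f → f ≈ₛ h ÷ (1ₛ -ₛ e)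
    fixedPoint⇒÷ {f} {h} f≈ = geometric , inverse , quotient
      where
      cancel : ∀ {u v w} → u ≈ v ⊕ w → u ⊕ neg w ≈ v
      cancel {u} {v} {w} u≈ = ≈-trans (+-congʳ u≈) (≈-trans (+-assoc v w _)
        (≈-trans (+-congˡ (-‿inverseʳ w)) (+-identityʳ v)))

      inverse : (1ₛ -ₛ e) *ₛ geometric ≈ₛ 1ₛ
      inverse N = begin
        ((1ₛ -ₛ e) *ₛ geometric) N                       ≈⟨ *ₛ-distribʳ geometric 1ₛ (- e) N ⟩
        (1ₛ *ₛ geometric) N ⊕ ((- e) *ₛ geometric) N     ≈⟨ +-cong (*ₛ-identityˡ geometric N) (*ₛ-negˡ e geometric N) ⟩
        geometric N ⊕ (- (e *ₛ geometric)) N             ≈⟨ cancel (geometric-rec N) ⟩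
        1ₛ N                                             ∎

      product : (1ₛ -ₛ e) *ₛ f ≈ₛ h
      product N = begin
        ((1ₛ -ₛ e) *ₛ f) N               ≈⟨ *ₛ-distribʳ f 1ₛ (- e) N ⟩
        (1ₛ *ₛ f) N ⊕ ((- e) *ₛ f) N     ≈⟨ +-cong (*ₛ-identityˡ f N) (*ₛ-negˡ e f N) ⟩
        f N ⊕ (- (e *ₛ f)) N             ≈⟨ cancel (f≈ N) ⟩
        h N                              ∎

      quotient : f ≈ₛ h *ₛ geometric
      quotient N = begin
        f N                                  ≈⟨ *ₛ-identityˡ f N ⟨
        (1ₛ *ₛ f) N                          ≈⟨ *ₛ-cong {g = f} inverse (λ _ → ≈-refl) N ⟨
        (((1ₛ -ₛ e) *ₛ geometric) *ₛ f) N    ≈⟨ *ₛ-cong {g = f} (*ₛ-comm (1ₛ -ₛ e) geometric) (λ _ → ≈-refl) N ⟩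
        ((geometric *ₛ (1ₛ -ₛ e)) *ₛ f) N    ≈⟨ *ₛ-assoc geometric (1ₛ -ₛ e) f N ⟩
        (geometric *ₛ ((1ₛ -ₛ e) *ₛ f)) N    ≈⟨ *ₛ-cong {f = geometric} (λ _ → ≈-refl) product N ⟩
        (geometric *ₛ h) N                   ≈⟨ *ₛ-comm geometric h N ⟩
        (h *ₛ geometric) N                   ∎

------------------------------------------------------------------------
-- The commutative ring ℚ[x]

module PolynomialRing where

  module ℚSeries where
    open Series (CommutativeRing.rawRing ℚ.+-*-commutativeRing) public
    open SeriesRing ℚ.+-*-commutativeRing public

  coeff-+ : ∀ p q i → coeff (p +ₚ q) i ≡ coeff p i ℚ.+ coeff q i
  coeff-+ []      q       i       = sym (ℚ.+-identityˡ (coeff q i))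
  coeff-+ (a ∷ p) []      i       = sym (ℚ.+-identityʳ (coeff (a ∷ p) i))
  coeff-+ (a ∷ p) (b ∷ q) zero    = refl
  coeff-+ (a ∷ p) (b ∷ q) (suc i) = coeff-+ p q i

  coeff-neg : ∀ p i → coeff (-ₚ p) i ≡ ℚ.- coeff p i
  coeff-neg []      i       = refl
  coeff-neg (a ∷ p) zero    = refl
  coeff-neg (a ∷ p) (suc i) = coeff-neg p i

  coeff-scalar : ∀ a p i → coeff (map (a ℚ.*_) p) i ≡ a ℚ.* coeff p i
  coeff-scalar a []      i       = sym (ℚ.*-zeroʳ a)
  coeff-scalar a (b ∷ p) zero    = refl
  coeff-scalar a (b ∷ p) (suc i) = coeff-scalar a p i

  -- The head coefficient of p and its tail play the roles of the constant
  -- coefficient and the tail of a series in *ₛ-suc.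
  coeff-* : ∀ p q i → coeff (p *ₚ q) i ≡ (coeff p ℚSeries.*ₛ coeff q) i
  coeff-* []      q i = sym (ℚSeries.*ₛ-zeroˡ (coeff q) i)
  coeff-* (a ∷ p) q zero = begin
    coeff (map (a ℚ.*_) q +ₚ (0ℚ ∷ p *ₚ q)) 0    ≡⟨ coeff-+ (map (a ℚ.*_) q) _ 0 ⟩
    coeff (map (a ℚ.*_) q) 0 ℚ.+ 0ℚ              ≡⟨ cong (ℚ._+ 0ℚ) (coeff-scalar a q 0) ⟩
    a ℚ.* coeff q 0 ℚ.+ 0ℚ                       ∎
    where open ≡.≡-Reasoning
  coeff-* (a ∷ p) q (suc i) = begin
    coeff (map (a ℚ.*_) q +ₚ (0ℚ ∷ p *ₚ q)) (suc i)
      ≡⟨ coeff-+ (map (a ℚ.*_) q) _ (suc i) ⟩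
    coeff (map (a ℚ.*_) q) (suc i) ℚ.+ coeff (p *ₚ q) i
      ≡⟨ cong₂ ℚ._+_ (coeff-scalar a q (suc i)) (coeff-* p q i) ⟩
    a ℚ.* coeff q (suc i) ℚ.+ (coeff p ℚSeries.*ₛ coeff q) i
      ≡⟨ ℚSeries.*ₛ-suc (coeff (a ∷ p)) (coeff q) i ⟨
    (coeff (a ∷ p) ℚSeries.*ₛ coeff q) (suc i) ∎
    where open ≡.≡-Reasoning

  coeff-1 : ∀ i → coeff 1ₚ i ≡ ℚSeries.1ₛ i
  coeff-1 zero    = refl
  coeff-1 (suc i) = refl

  private
    open ≡.≡-Reasoning

    via-+ : ∀ p q {p′ q′ : ℕ → ℚ} i → coeff p i ≡ p′ i → coeff q i ≡ q′ i →
      coeff (p +ₚ q) i ≡ p′ i ℚ.+ q′ i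
    via-+ p q i p≡ q≡ = trans (coeff-+ p q i) (cong₂ ℚ._+_ p≡ q≡)

    via-* : ∀ p q {p′ q′ : ℕ → ℚ} i → (∀ j → coeff p j ≡ p′ j) → (∀ j → coeff q j ≡ q′ j) →
      coeff (p *ₚ q) i ≡ (p′ ℚSeries.*ₛ q′) i
    via-* p q {p′} {q′} i p≡ q≡ =
      trans (coeff-* p q i) (ℚSeries.*ₛ-cong {coeff p} {p′} {coeff q} {q′} p≡ q≡ i)

  *ₚ-comm : ∀ p q → p *ₚ q ≈ₚ q *ₚ p
  *ₚ-comm p q i = begin
    coeff (p *ₚ q) i                    ≡⟨ coeff-* p q i ⟩
    (coeff p ℚSeries.*ₛ coeff q) i      ≡⟨ ℚSeries.*ₛ-comm (coeff p) (coeff q) i ⟩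
    (coeff q ℚSeries.*ₛ coeff p) i      ≡⟨ coeff-* q p i ⟨
    coeff (q *ₚ p) i                    ∎

  *ₚ-cong : ∀ {p p′ q q′} → p ≈ₚ p′ → q ≈ₚ q′ → p *ₚ q ≈ₚ p′ *ₚ q′
  *ₚ-cong {p} {p′} {q} {q′} p≈ q≈ i = trans (via-* p q i p≈ q≈) (sym (coeff-* p′ q′ i))

  *ₚ-assoc : ∀ p q r → (p *ₚ q) *ₚ r ≈ₚ p *ₚ (q *ₚ r)
  *ₚ-assoc p q r i = begin
    coeff ((p *ₚ q) *ₚ r) i
      ≡⟨ via-* (p *ₚ q) r i (coeff-* p q) (λ _ → refl) ⟩
    ((coeff p ℚSeries.*ₛ coeff q) ℚSeries.*ₛ coeff r) i
      ≡⟨ ℚSeries.*ₛ-assoc (coeff p) (coeff q) (coeff r) i ⟩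
    (coeff p ℚSeries.*ₛ (coeff q ℚSeries.*ₛ coeff r)) i
      ≡⟨ via-* p (q *ₚ r) i (λ _ → refl) (coeff-* q r) ⟨
    coeff (p *ₚ (q *ₚ r)) i ∎

  *ₚ-distribʳ : ∀ r p q → (p +ₚ q) *ₚ r ≈ₚ p *ₚ r +ₚ q *ₚ r
  *ₚ-distribʳ r p q i = begin
    coeff ((p +ₚ q) *ₚ r) i
      ≡⟨ via-* (p +ₚ q) r i (coeff-+ p q) (λ _ → refl) ⟩
    ((coeff p ℚSeries.+ₛ coeff q) ℚSeries.*ₛ coeff r) i
      ≡⟨ ℚSeries.*ₛ-distribʳ (coeff r) (coeff p) (coeff q) i ⟩
    (coeff p ℚSeries.*ₛ coeff r) i ℚ.+ (coeff q ℚSeries.*ₛ coeff r) i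
      ≡⟨ cong₂ ℚ._+_ (coeff-* p r i) (coeff-* q r i) ⟨
    coeff (p *ₚ r) i ℚ.+ coeff (q *ₚ r) i
      ≡⟨ coeff-+ (p *ₚ r) (q *ₚ r) i ⟨
    coeff (p *ₚ r +ₚ q *ₚ r) i ∎

  *ₚ-identityˡ : ∀ p → 1ₚ *ₚ p ≈ₚ p
  *ₚ-identityˡ p i =
    trans (via-* 1ₚ p i coeff-1 (λ _ → refl)) (ℚSeries.*ₛ-identityˡ (coeff p) i)

  ℚ[x]-commutativeRing : CommutativeRing 0ℓ 0ℓ
  ℚ[x]-commutativeRing = record
    { Carrier = Poly ; _≈_ = _≈ₚ_ ; _+_ = _+ₚ_ ; _*_ = _*ₚ_ ; -_ = -ₚ_ ; 0# = [] ; 1# = 1ₚ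
    ; isCommutativeRing = record
      { isRing = record
        { +-isAbelianGroup = record
          { isGroup = record
            { isMonoid = record
              { isSemigroup = record
                { isMagma = record
                  { isEquivalence = record
                    { refl  = λ _ → refl
                    ; sym   = λ p≈q i → sym (p≈q i)
                    ; trans = λ p≈q q≈r i → trans (p≈q i) (q≈r i)
                    }
                  ; ∙-cong = λ {p} {p′} {q} {q′} p≈ q≈ i →
                      trans (via-+ p q {coeff p′} {coeff q′} i (p≈ i) (q≈ i)) (sym (coeff-+ p′ q′ i))
                  }
                ; assoc = assoc
                }
              ; identity = identityˡ , λ p i → trans (comm p [] i) (identityˡ p i)
              }
            ; inverse = inverseˡ , λ p i → trans (comm p (-ₚ p) i) (inverseˡ p i)
            ; ⁻¹-cong = λ {p} {q} p≈q i → begin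
                coeff (-ₚ p) i   ≡⟨ coeff-neg p i ⟩
                ℚ.- coeff p i    ≡⟨ cong ℚ.-_ (p≈q i) ⟩
                ℚ.- coeff q i    ≡⟨ coeff-neg q i ⟨
                coeff (-ₚ q) i   ∎
            }
          ; comm = comm
          }
        ; *-cong = λ {p} {p′} {q} {q′} → *ₚ-cong {p} {p′} {q} {q′}
        ; *-assoc = *ₚ-assoc
        ; *-identity = *ₚ-identityˡ , λ p i → trans (*ₚ-comm p 1ₚ i) (*ₚ-identityˡ p i)
        ; distrib = distribˡ , *ₚ-distribʳ
        }
      ; *-comm = *ₚ-comm
      }
    }
    where
    comm : ∀ p q → p +ₚ q ≈ₚ q +ₚ p
    comm p q i = trans (coeff-+ p q i)
      (trans (ℚ.+-comm (coeff p i) (coeff q i)) (sym (coeff-+ q p i)))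

    assoc : ∀ p q r → (p +ₚ q) +ₚ r ≈ₚ p +ₚ (q +ₚ r)
    assoc p q r i = begin
      coeff ((p +ₚ q) +ₚ r) i                       ≡⟨ coeff-+ (p +ₚ q) r i ⟩
      coeff (p +ₚ q) i ℚ.+ coeff r i                ≡⟨ cong (ℚ._+ coeff r i) (coeff-+ p q i) ⟩
      coeff p i ℚ.+ coeff q i ℚ.+ coeff r i         ≡⟨ ℚ.+-assoc (coeff p i) (coeff q i) (coeff r i) ⟩
      coeff p i ℚ.+ (coeff q i ℚ.+ coeff r i)       ≡⟨ cong (coeff p i ℚ.+_) (coeff-+ q r i) ⟨
      coeff p i ℚ.+ coeff (q +ₚ r) i                ≡⟨ coeff-+ p (q +ₚ r) i ⟨
      coeff (p +ₚ (q +ₚ r)) i                       ∎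

    identityˡ : ∀ p → [] +ₚ p ≈ₚ p
    identityˡ p i = refl

    inverseˡ : ∀ p → -ₚ p +ₚ p ≈ₚ []
    inverseˡ p i = begin
      coeff (-ₚ p +ₚ p) i              ≡⟨ coeff-+ (-ₚ p) p i ⟩
      coeff (-ₚ p) i ℚ.+ coeff p i     ≡⟨ cong (ℚ._+ coeff p i) (coeff-neg p i) ⟩
      ℚ.- coeff p i ℚ.+ coeff p i      ≡⟨ ℚ.+-inverseˡ (coeff p i) ⟩
      0ℚ                               ∎

    distribˡ : ∀ r p q → r *ₚ (p +ₚ q) ≈ₚ r *ₚ p +ₚ r *ₚ q
    distribˡ r p q i = begin
      coeff (r *ₚ (p +ₚ q)) i                       ≡⟨ *ₚ-comm r (p +ₚ q) i ⟩
      coeff ((p +ₚ q) *ₚ r) i                       ≡⟨ *ₚ-distribʳ r p q i ⟩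
      coeff (p *ₚ r +ₚ q *ₚ r) i
        ≡⟨ via-+ (p *ₚ r) (q *ₚ r) {coeff (r *ₚ p)} {coeff (r *ₚ q)} i (*ₚ-comm p r i) (*ₚ-comm q r i) ⟩
      coeff (r *ₚ p) i ℚ.+ coeff (r *ₚ q) i         ≡⟨ coeff-+ (r *ₚ p) (r *ₚ q) i ⟨
      coeff (r *ₚ p +ₚ r *ₚ q) i                    ∎

  open import Algebra.Properties.Semiring.Mult (CommutativeRing.semiring ℚ[x]-commutativeRing)
    using () renaming (_×_ to _·_)

  fromℕ≈· : ∀ m → fromℕ m ≈ₚ m · 1ₚ
  fromℕ≈· zero    zero    = refl
  fromℕ≈· zero    (suc i) = refl
  fromℕ≈· (suc m) zero    = begin
    + suc m ℚ./ 1
      ≡⟨ ℚ.toℚᵘ-injective (ℚᵘ.≃-trans (ℚ.toℚᵘ-fromℚᵘ (mkℚᵘ (+ suc m) 0)) (ℚᵘ.≃-sym step)) ⟩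
    1ℚ ℚ.+ + m ℚ./ 1             ≡⟨ cong (1ℚ ℚ.+_) (fromℕ≈· m 0) ⟩
    1ℚ ℚ.+ coeff (m · 1ₚ) 0      ≡⟨ coeff-+ 1ₚ (m · 1ₚ) 0 ⟨
    coeff (suc m · 1ₚ) 0         ∎
    where
    step : ℚ.toℚᵘ (1ℚ ℚ.+ + m ℚ./ 1) ℚᵘ.≃ mkℚᵘ (+ suc m) 0
    step = ℚᵘ.≃-trans (ℚ.toℚᵘ-homo-+ 1ℚ (+ m ℚ./ 1))
      (ℚᵘ.≃-trans (ℚᵘ.+-congʳ (mkℚᵘ (+ 1) 0) (ℚ.toℚᵘ-fromℚᵘ (mkℚᵘ (+ m) 0)))
        (*≡* (cong (ℤ._* + 1) (cong (λ z → + 1 ℤ.+ z) (ℤ.*-identityʳ (+ m))))))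
  fromℕ≈· (suc m) (suc i) = begin
    coeff (fromℕ m) (suc i)          ≡⟨ fromℕ≈· m (suc i) ⟩
    coeff (m · 1ₚ) (suc i)           ≡⟨ ℚ.+-identityˡ _ ⟨
    0ℚ ℚ.+ coeff (m · 1ₚ) (suc i)    ≡⟨ coeff-+ 1ₚ (m · 1ₚ) (suc i) ⟨
    coeff (suc m · 1ₚ) (suc i)       ∎

  n*1/n≡1 : ∀ n .{{_ : NonZero n}} → (+ n ℚ./ 1) ℚ.* (+ 1 ℚ./ n) ≡ 1ℚ
  n*1/n≡1 (suc n) = ℚ.toℚᵘ-injective (ℚᵘ.≃-trans (ℚ.toℚᵘ-homo-* (+ suc n ℚ./ 1) (+ 1 ℚ./ suc n))
    (ℚᵘ.≃-trans (ℚᵘ.*-cong (ℚ.toℚᵘ-fromℚᵘ (mkℚᵘ (+ suc n) 0)) (ℚ.toℚᵘ-fromℚᵘ (mkℚᵘ (+ 1) n)))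
      (*≡* (begin
        + suc n ℤ.* + 1 ℤ.* + 1    ≡⟨ ℤ.*-assoc (+ suc n) (+ 1) (+ 1) ⟩
        + suc n ℤ.* + 1            ≡⟨ ℤ.*-comm (+ suc n) (+ 1) ⟩
        + 1 ℤ.* + suc n            ≡⟨ cong (λ z → + 1 ℤ.* z) (ℤ.*-identityˡ (+ suc n)) ⟨
        + 1 ℤ.* (+ 1 ℤ.* + suc n)  ∎))))

  !*1/! : ∀ m → ((m !) · 1ₚ) *ₚ 1/[ m !] ≈ₚ 1ₚ
  !*1/! m i = trans
    (*ₚ-cong {(m !) · 1ₚ} {fromℕ (m !)} {1/[ m !]} {1/[ m !]} (λ j → sym (fromℕ≈· (m !) j)) (λ _ → refl) i)
    (go i)
    where
    go : fromℕ (m !) *ₚ 1/[ m !] ≈ₚ 1ₚ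
    go zero    = trans (ℚ.+-identityʳ _) (n*1/n≡1 (m !) {{m !≢0}})
    go (suc i) = refl

open PolynomialRing using (ℚ[x]-commutativeRing; fromℕ≈·; !*1/!)

------------------------------------------------------------------------
-- Splitting a list in two

unique∧sameElements⇒↭ : ∀ {xs ys : List A} → Unique xs → Unique ys →
  (∀ {z} → z ∈ xs → z ∈ ys) → (∀ {z} → z ∈ ys → z ∈ xs) → xs ↭ ys
unique∧sameElements⇒↭ xs! ys! xs⊆ys ys⊆xs =
  ∼bag⇒↭ (unique∧set⇒bag xs! ys! (mk⇔ xs⊆ys ys⊆xs))

-- All ways to distribute the positions of a list over two sublists, the
-- first of which has length s.
splits : ℕ → List A → List (List A × List A)
splits zero    xs       = ([] , xs) ∷ []
splits (suc s) []       = []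
splits (suc s) (x ∷ xs) =
  map (map₁ (x ∷_)) (splits s xs) List.++ map (map₂ (x ∷_)) (splits (suc s) xs)

splits-sound : ∀ s (xs : List A) {ys zs} → (ys , zs) ∈ splits s xs →
  ys ⊑ xs × zs ⊑ xs × ys List.++ zs ↭ xs × length ys ≡ s
splits-sound zero    xs       (here refl) = minimum xs , ⊆-refl , ↭-refl , refl
splits-sound (suc s) (x ∷ xs) p with ∈-++⁻ (map (map₁ (x ∷_)) (splits s xs)) p
... | inj₁ q with (ys , zs) , r , refl ← ∈-map⁻ (map₁ (x ∷_)) q
             with ys⊆ , zs⊆ , ys++zs↭ , |ys| ← splits-sound s xs r
    = refl ∷ ys⊆ , x ∷ʳ zs⊆ , prep x ys++zs↭ , cong suc |ys|
... | inj₂ q with (ys , zs) , r , refl ← ∈-map⁻ (map₂ (x ∷_)) q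
             with ys⊆ , zs⊆ , ys++zs↭ , |ys| ← splits-sound (suc s) xs r
    = x ∷ʳ ys⊆ , refl ∷ zs⊆ , ↭-trans (shift x ys zs) (prep x ys++zs↭) , |ys|

-- Each division of the elements of xs into two parts, in whatever order, comes
-- from a split.
splits-complete : ∀ s (xs : List A) {us vs} → us List.++ vs ↭ xs → length us ≡ s →
  ∃ λ p → p ∈ splits s xs × us ↭ proj₁ p × vs ↭ proj₂ p
splits-complete zero    xs       {[]}     p refl = _ , here refl , ↭-refl , p
splits-complete (suc s) []       {u ∷ us} p _ with () ← ↭-empty-inv p
splits-complete (suc s) (x ∷ xs) {us} {vs} p |us|
  with ∈-++⁻ us (∈-resp-↭ (↭-sym p) (here refl))
... | inj₁ x∈us with us₁ , us₂ , refl ← ∈-∃++ x∈us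
    = map₁ (x ∷_) q , ∈-++⁺ˡ (∈-map⁺ (map₁ (x ∷_)) q∈) , ↭-trans us↭ (prep x us↭q) , vs↭q
  where
  us↭ : us₁ List.++ x ∷ us₂ ↭ x ∷ us₁ List.++ us₂
  us↭ = shift x us₁ us₂
  rec = splits-complete s xs {us₁ List.++ us₂} {vs}
    (drop-∷ (↭-trans (↭-sym (++⁺ʳ vs us↭)) p))
    (ℕ.suc-injective (trans (sym (↭-length us↭)) |us|))
  q = proj₁ rec
  q∈ = proj₁ (proj₂ rec)
  us↭q = proj₁ (proj₂ (proj₂ rec))
  vs↭q = proj₂ (proj₂ (proj₂ rec))
... | inj₂ x∈vs with vs₁ , vs₂ , refl ← ∈-∃++ x∈vs
    = map₂ (x ∷_) q , ∈-++⁺ʳ _ (∈-map⁺ (map₂ (x ∷_)) q∈) , us↭q , ↭-trans vs↭ (prep x vs↭q)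
  where
  vs↭ : vs₁ List.++ x ∷ vs₂ ↭ x ∷ vs₁ List.++ vs₂
  vs↭ = shift x vs₁ vs₂
  rec = splits-complete (suc s) xs {us} {vs₁ List.++ vs₂}
    (drop-∷ (↭-trans (↭-sym (↭-trans (++⁺ˡ us vs↭) (shift x us (vs₁ List.++ vs₂)))) p))
    |us|
  q = proj₁ rec
  q∈ = proj₁ (proj₂ rec)
  us↭q = proj₁ (proj₂ (proj₂ rec))
  vs↭q = proj₂ (proj₂ (proj₂ rec))

-- Different splits have first parts with different elements.
splits-separated : ∀ s {xs : List A} → Unique xs →
  AllPairs (λ p q → ¬ (proj₁ p ↭ proj₁ q)) (splits s xs)
splits-separated zero    xs!        = [] ∷ []
splits-separated (suc s) []         = []
splits-separated (suc s) {x ∷ xs} (x∉xs ∷ xs!) = AllPairs.++⁺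
  (AllPairs.map⁺ (AllPairs.map (_∘ drop-∷) (splits-separated s xs!)))
  (AllPairs.map⁺ (splits-separated (suc s) xs!))
  (All.map⁺ (All.tabulate λ _ → All.map⁺ (All.tabulate λ q∈ x∷ys↭zs →
    All.All¬⇒¬Any x∉xs (Any-resp-⊆ (proj₁ (splits-sound (suc s) xs q∈)) (∈-resp-↭ x∷ys↭zs (here refl))))))

length-splits : ∀ s (xs : List A) → length (splits s xs) ≡ length xs C s
length-splits zero    xs       = refl
length-splits (suc s) []       = refl
length-splits (suc s) (x ∷ xs) = begin
  length (map (map₁ (x ∷_)) (splits s xs) List.++ map (map₂ (x ∷_)) (splits (suc s) xs))
    ≡⟨ List.length-++ (map (map₁ (x ∷_)) (splits s xs)) ⟩
  length (map (map₁ (x ∷_)) (splits s xs)) + length (map (map₂ (x ∷_)) (splits (suc s) xs))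
    ≡⟨ cong₂ _+_ (List.length-map _ (splits s xs)) (List.length-map _ (splits (suc s) xs)) ⟩
  length (splits s xs) + length (splits (suc s) xs)
    ≡⟨ cong₂ _+_ (length-splits s xs) (length-splits (suc s) xs) ⟩
  length xs C s + length xs C suc s
    ≡⟨ nCk+nC[k+1]≡[n+1]C[k+1] (length xs) s ⟩
  suc (length xs) C suc s ∎
  where open ≡.≡-Reasoning

C*!*!≡! : ∀ s t → ((s + t) C s) * (s ! * t !) ≡ (s + t) !
C*!*!≡! s t = begin
  ((s + t) C s) * (s ! * t !)
    ≡⟨ cong (λ u → ((s + t) C s) * (s ! * u !)) (ℕ.m+n∸m≡n s t) ⟨
  ((s + t) C s) * (s ! * (s + t ∸ s) !)
    ≡⟨ cong (_* (s ! * (s + t ∸ s) !)) (nCk≡n!/k![n-k]! s≤s+t) ⟩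
  ((s + t) ! / (s ! * (s + t ∸ s) !)) * (s ! * (s + t ∸ s) !)
    ≡⟨ m/n*n≡m (k![n∸k]!∣n! s≤s+t) ⟩
  (s + t) ! ∎
  where
  open ≡.≡-Reasoning
  s≤s+t = ℕ.m≤m+n s t
  instance _ = ℕ._!*_!≢0 s (s + t ∸ s)

------------------------------------------------------------------------
-- Fillings with prescribed entries

-- The definitions of IsFilling and 𝓕, with an arbitrary list L of numbers
-- in place of 1, …, k n; 𝓕 n k is 𝓕-over [1… k * n ] n k by definition.

IsFillingOver : ∀ {n k} → List ℕ → Pred (Array n k) 0ℓ
IsFillingOver L F = entries F ↭ L × VecAll.All (Linked _<_) F

isFillingOver? : ∀ {n k} L → Decidable (IsFillingOver {n} {k} L)
isFillingOver? L F = (entries F ↭? L) ×-dec VecAll.all? (Linked.linked? ℕ._<?_) F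

𝓕-over : List ℕ → ∀ n k → List (Array n k)
𝓕-over L n k = filter (isFillingOver? L) (vectorsOver (vectorsOver L k) n)

entries-++ : ∀ {m n k} (G : Array m k) (H : Array n k) →
  entries (G Vec.++ H) ≡ entries G List.++ entries H
entries-++ []      H = refl
entries-++ (c ∷ G) H = begin
  toList (c Vec.++ Vec.concat (G Vec.++ H))             ≡⟨ Vec.toList-++ c _ ⟩
  toList c List.++ entries (G Vec.++ H)                 ≡⟨ cong (toList c List.++_) (entries-++ G H) ⟩
  toList c List.++ (entries G List.++ entries H)        ≡⟨ List.++-assoc (toList c) (entries G) (entries H) ⟨
  (toList c List.++ entries G) List.++ entries H        ≡⟨ cong (List._++ entries H) (Vec.toList-++ c _) ⟨
  entries (c ∷ G) List.++ entries H                     ∎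
  where open ≡.≡-Reasoning

length-entries : ∀ {n k} (F : Array n k) → length (entries F) ≡ k * n
length-entries {n} {k} F = trans (Vec.length-toList (Vec.concat F)) (ℕ.*-comm n k)

vectorsOver-unique : ∀ {as : List A} n → Unique as → Unique (vectorsOver as n)
vectorsOver-unique zero    as! = [] ∷ []
vectorsOver-unique (suc n) as! =
  Unique.cartesianProductWith⁺ _∷_ Vec.∷-injective as! (vectorsOver-unique n as!)

∈-vectorsOver : ∀ {as : List A} {n} {v : Vec A n} → VecAll.All (_∈ as) v → v ∈ vectorsOver as n
∈-vectorsOver VecAll.[]        = here refl
∈-vectorsOver (a∈ VecAll.∷ v∈) = ∈-cartesianProductWith⁺ _∷_ a∈ (∈-vectorsOver v∈)

columns∈ : ∀ {n k L} (F : Array n k) → All (_∈ L) (entries F) → VecAll.All (_∈ vectorsOver L k) F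
columns∈ []      _  = VecAll.[]
columns∈ {L = L} (c ∷ F) es with p , q ← All.++⁻ (toList c) (subst (All (_∈ L)) (Vec.toList-++ c (Vec.concat F)) es)
  = ∈-vectorsOver (toListAll p) VecAll.∷ columns∈ F q
  where
  toListAll : ∀ {n} {v : Vec ℕ n} → All (_∈ L) (toList v) → VecAll.All (_∈ L) v
  toListAll {v = []}    []       = VecAll.[]
  toListAll {v = x ∷ v} (p ∷ ps) = p VecAll.∷ toListAll ps

∈-𝓕-over⁺ : ∀ {L n k} {F : Array n k} → IsFillingOver L F → F ∈ 𝓕-over L n k
∈-𝓕-over⁺ {L} {F = F} F-filling = ∈-filter⁺ (isFillingOver? L)
  (∈-vectorsOver (columns∈ F (All.tabulate (∈-resp-↭ (proj₁ F-filling))))) F-filling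

∈-𝓕-over⁻ : ∀ {L n k} {F : Array n k} → F ∈ 𝓕-over L n k → IsFillingOver L F
∈-𝓕-over⁻ {L} {n} {k} F∈ = proj₂ (∈-filter⁻ (isFillingOver? L) {xs = vectorsOver (vectorsOver L k) n} F∈)

𝓕-over-unique : ∀ {L} n k → Unique L → Unique (𝓕-over L n k)
𝓕-over-unique {L} n k L! =
  Unique.filter⁺ (isFillingOver? L) (vectorsOver-unique n (vectorsOver-unique k L!))

AllPairs-resp-⊆ : ∀ {R : A → A → Set} {xs ys} → xs ⊑ ys → AllPairs R ys → AllPairs R xs
AllPairs-resp-⊆ []         []         = []
AllPairs-resp-⊆ (y ∷ʳ p)   (_ ∷ ys!)  = AllPairs-resp-⊆ p ys!
AllPairs-resp-⊆ (refl ∷ p) (y ∷ ys!)  = All-resp-⊆ p y ∷ AllPairs-resp-⊆ p ys!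

-- The fillings with m + n columns, sorted by the set S of entries of the
-- first m columns.
𝓕-split : List ℕ → ∀ m n k → List (Array (m + n) k)
𝓕-split L m n k = concat (map
  (λ (S , T) → cartesianProductWith Vec._++_ (𝓕-over S m k) (𝓕-over T n k))
  (splits (k * m) L))

𝓕-over-++ : ∀ {L} m n k → Unique L → 𝓕-over L (m + n) k ↭ 𝓕-split L m n k
𝓕-over-++ {L} m n k L! = unique∧sameElements⇒↭ (𝓕-over-unique (m + n) k L!) unique to from
  where
  glue : List ℕ × List ℕ → List (Array (m + n) k)
  glue (S , T) = cartesianProductWith Vec._++_ (𝓕-over S m k) (𝓕-over T n k)

  glue⁻ : ∀ {S T F} → F ∈ glue (S , T) →
    ∃ λ G → ∃ λ H → F ≡ G Vec.++ H × IsFillingOver S G × IsFillingOver T H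
  glue⁻ {S} {T} F∈ with G , H , G∈ , H∈ , refl ← ∈-cartesianProductWith⁻ Vec._++_ (𝓕-over S m k) (𝓕-over T n k) F∈
    = G , H , refl , ∈-𝓕-over⁻ G∈ , ∈-𝓕-over⁻ H∈

  unique : Unique (𝓕-split L m n k)
  unique = Unique.concat⁺
    (All.map⁺ (All.tabulate λ {(S , T)} p∈ →
      let S⊆ , T⊆ , _ = splits-sound (k * m) L p∈ in
      Unique.cartesianProductWith⁺ Vec._++_ (λ {G} {G′} → Vec.++-injective G G′)
        (𝓕-over-unique m k (AllPairs-resp-⊆ S⊆ L!)) (𝓕-over-unique n k (AllPairs-resp-⊆ T⊆ L!))))
    (AllPairs.map⁺ (AllPairs.map disjoint (splits-separated (k * m) L!)))
    where
    disjoint : ∀ {p q} → ¬ (proj₁ p ↭ proj₁ q) → ∀ {F} → ¬ (F ∈ glue p × F ∈ glue q)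
    disjoint S≁S′ (F∈p , F∈q)
      with G , H , refl , (G↭S , _) , _ ← glue⁻ F∈p | G′ , H′ , eq , (G′↭S′ , _) , _ ← glue⁻ F∈q
      with refl ← Vec.++-injectiveˡ G G′ eq
      = S≁S′ (↭-trans (↭-sym G↭S) G′↭S′)

  to : ∀ {F} → F ∈ 𝓕-over L (m + n) k → F ∈ 𝓕-split L m n k
  to {F} F∈ with G , H , refl ← Vec.splitAt m F
            with F↭L , increasing ← ∈-𝓕-over⁻ F∈
            with G-inc , H-inc ← VecAll.++⁻ G increasing
            with (S , T) , p∈ , G↭S , H↭T ← splits-complete (k * m) L
                   (subst (_↭ L) (entries-++ G H) F↭L) (length-entries G)
    = ∈-concat⁺′ (∈-cartesianProductWith⁺ Vec._++_ (∈-𝓕-over⁺ (G↭S , G-inc)) (∈-𝓕-over⁺ (H↭T , H-inc)))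
        (∈-map⁺ glue p∈)

  from : ∀ {F} → F ∈ 𝓕-split L m n k → F ∈ 𝓕-over L (m + n) k
  from F∈ with _ , F∈glue , glue∈ ← ∈-concat⁻′ (map glue (splits (k * m) L)) F∈
          with (S , T) , p∈ , refl ← ∈-map⁻ glue glue∈
          with G , H , refl , (G↭S , G-inc) , (H↭T , H-inc) ← glue⁻ F∈glue
          with _ , _ , ST↭L , _ ← splits-sound (k * m) L p∈
    = ∈-𝓕-over⁺ (subst (_↭ L) (sym (entries-++ G H)) (↭-trans (++⁺ G↭S H↭T) ST↭L) , VecAll.++⁺ G-inc H-inc)

------------------------------------------------------------------------
-- Relabelling the entries

StrictlyMonotone : (ℕ → ℕ) → Set
StrictlyMonotone φ = ∀ {i j} → i < j → φ i < φ j

module _ {φ : ℕ → ℕ} (φ-mono : StrictlyMonotone φ) where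

  mono-injective : ∀ {i j} → φ i ≡ φ j → i ≡ j
  mono-injective {i} {j} eq with ℕ.<-cmp i j
  ... | tri< i<j _ _ = contradiction eq (ℕ.<⇒≢ (φ-mono i<j))
  ... | tri≈ _ i≡j _ = i≡j
  ... | tri> _ _ j<i = contradiction (sym eq) (ℕ.<⇒≢ (φ-mono j<i))

  mono-reflects-< : ∀ {i j} → φ i < φ j → i < j
  mono-reflects-< {i} {j} lt with ℕ.<-cmp i j
  ... | tri< i<j _ _  = i<j
  ... | tri≈ _ refl _ = contradiction lt (ℕ.<-irrefl refl)
  ... | tri> _ _ j<i  = contradiction lt (ℕ.<-asym (φ-mono j<i))

  mono-≤-⇔ : ∀ {i j} → (φ i ≤ φ j) ⇔ (i ≤ j)
  mono-≤-⇔ = mk⇔ (λ le → ℕ.≮⇒≥ (λ j<i → ℕ.<⇒≱ (φ-mono j<i) le))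
            (λ le → ℕ.≮⇒≥ (λ lt → ℕ.<⇒≱ (mono-reflects-< lt) le))

-- The array with each entry v replaced by φ v.
relabel : ∀ {n k} → (ℕ → ℕ) → Array n k → Array n k
relabel φ = Vec.map (Vec.map φ)

entries-relabel : ∀ {n k} φ (F : Array n k) → entries (relabel φ F) ≡ map φ (entries F)
entries-relabel φ []      = refl
entries-relabel φ (c ∷ F) = begin
  toList (Vec.map φ c Vec.++ Vec.concat (relabel φ F))    ≡⟨ Vec.toList-++ (Vec.map φ c) _ ⟩
  toList (Vec.map φ c) List.++ entries (relabel φ F)      ≡⟨ cong₂ List._++_ (Vec.toList-map φ c) (entries-relabel φ F) ⟩
  map φ (toList c) List.++ map φ (entries F)              ≡⟨ List.map-++ φ (toList c) (entries F) ⟨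
  map φ (toList c List.++ entries F)                      ≡⟨ cong (map φ) (Vec.toList-++ c _) ⟨
  map φ (entries (c ∷ F))                                 ∎
  where open ≡.≡-Reasoning

-- Only the relative order of the entries matters for red.
red-relabel : ∀ {φ n k} → StrictlyMonotone φ → (F : Array n k) → red (relabel φ F) ≡ red F
red-relabel {φ} mono F = begin
  Vec.map (Vec.map (rank (entries (relabel φ F)))) (relabel φ F)
    ≡⟨ Vec.map-∘ _ _ F ⟨
  Vec.map (Vec.map (rank (entries (relabel φ F))) ∘ Vec.map φ) F
    ≡⟨ Vec.map-cong (λ c → trans (sym (Vec.map-∘ _ _ c)) (Vec.map-cong rank-φ c)) F ⟩
  Vec.map (Vec.map (rank (entries F))) F ∎
  where
  open ≡.≡-Reasoning
  rank : List ℕ → ℕ → ℕ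
  rank es v = length (filter (ℕ._≤? v) es)

  rank-map : ∀ v es → rank (map φ es) (φ v) ≡ rank es v
  rank-map v []       = refl
  rank-map v (e ∷ es) rewrite does-⇔ (mono-≤-⇔ mono) (φ e ℕ.≤? φ v) (e ℕ.≤? v) with does (e ℕ.≤? v)
  ... | true  = cong suc (rank-map v es)
  ... | false = rank-map v es

  rank-φ : ∀ v → rank (entries (relabel φ F)) (φ v) ≡ rank (entries F) v
  rank-φ v = trans (cong (λ es → rank es (φ v)) (entries-relabel φ F)) (rank-map v (entries F))

vectorsOver-map : ∀ {B : Set} (f : A → B) as n →
  vectorsOver (map f as) n ≡ map (Vec.map f) (vectorsOver as n)
vectorsOver-map {A = A} {B} f as zero    = refl
vectorsOver-map {A = A} {B} f as (suc n) =
  trans (cong (cartesianProductWith _∷_ (map f as)) (vectorsOver-map f as n)) (product as (vectorsOver as n))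
  where
  open ≡.≡-Reasoning
  product : ∀ as (vs : List (Vec A n)) →
    cartesianProductWith _∷_ (map f as) (map (Vec.map f) vs) ≡
    map (Vec.map f) (cartesianProductWith _∷_ as vs)
  product []       vs = refl
  product (a ∷ as) vs = begin
    map (f a ∷_) (map (Vec.map f) vs) List.++ cartesianProductWith _∷_ (map f as) (map (Vec.map f) vs)
      ≡⟨ cong₂ List._++_ (trans (sym (List.map-∘ vs)) (List.map-∘ vs)) (product as vs) ⟩
    map (Vec.map f) (map (a ∷_) vs) List.++ map (Vec.map f) (cartesianProductWith _∷_ as vs)
      ≡⟨ List.map-++ (Vec.map f) (map (a ∷_) vs) _ ⟨
    map (Vec.map f) (map (a ∷_) vs List.++ cartesianProductWith _∷_ as vs) ∎

isFillingOver-relabel : ∀ {φ n k L} {F : Array n k} → StrictlyMonotone φ →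
  IsFillingOver (map φ L) (relabel φ F) ⇔ IsFillingOver L F
isFillingOver-relabel {φ} {L = L} {F} mono = mk⇔
  (λ (p , q) → drop-map (subst (_↭ map φ L) (entries-relabel φ F) p) ,
    VecAll.map (λ l → Linked.map (mono-reflects-< mono) (Linked.map⁻ l)) (VecAll.map⁻ q))
  (λ (p , q) → subst (_↭ map φ L) (sym (entries-relabel φ F)) (map⁺ φ p) ,
    VecAll.map⁺ (VecAll.map (λ l → Linked.map⁺ (Linked.map mono l)) q))
  where
  drop-map : ∀ {xs ys} → map φ xs ↭ map φ ys → xs ↭ ys
  drop-map {xs} p with zs , eq , xs↭zs ← ↭-map-inv φ p =
    subst (xs ↭_) (sym (List.map-injective (mono-injective mono) eq)) xs↭zs

-- The strictly monotone map with 0 ↦ c that maps 1, 2, … to the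
-- successive elements of an increasing list above c, and continues
-- with consecutive numbers when the list is exhausted.
interpolate : ℕ → List ℕ → ℕ → ℕ
interpolate c S       zero    = c
interpolate c []      (suc i) = interpolate (suc c) [] i
interpolate c (s ∷ S) (suc i) = interpolate s S i

interpolate-step : ∀ {c S} → AllPairs _<_ (c ∷ S) → ∀ i → interpolate c S i < interpolate c S (suc i)
interpolate-step {c} {[]}    _                 zero    = ℕ.n<1+n c
interpolate-step {c} {s ∷ S} ((c<s ∷ _) ∷ _)   zero    = c<s
interpolate-step {c} {[]}    _                 (suc i) = interpolate-step ([] ∷ []) i
interpolate-step {c} {s ∷ S} (_ ∷ S-inc)       (suc i) = interpolate-step S-inc i

interpolate-mono : ∀ {c S} → AllPairs _<_ (c ∷ S) → StrictlyMonotone (interpolate c S)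
interpolate-mono inc {i} {suc j} (s≤s i≤j) with ℕ.m≤n⇒m<n∨m≡n i≤j
... | inj₁ i<j  = ℕ.<-trans (interpolate-mono inc i<j) (interpolate-step inc j)
... | inj₂ refl = interpolate-step inc i

map-interpolate : ∀ c S → map (interpolate c S) [1… length S ] ≡ S
map-interpolate c S = trans (List.map-applyUpTo suc (interpolate c S) (length S)) (go c S)
  where
  go : ∀ c S → applyUpTo (interpolate c S ∘ suc) (length S) ≡ S
  go c []      = refl
  go c (s ∷ S) = cong (s ∷_) (go s S)

[1…n]-increasing : ∀ n → AllPairs _<_ [1… n ]
[1…n]-increasing n = AllPairs.applyUpTo⁺₁ suc n (λ i<j _ → s≤s i<j)

[1…n]-positive : ∀ n → All (0 <_) [1… n ]
[1…n]-positive n = All.applyUpTo⁺₂ suc n (λ _ → s≤s z≤n)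

[1…n]-unique : ∀ n → Unique [1… n ]
[1…n]-unique n = AllPairs.map ℕ.<⇒≢ ([1…n]-increasing n)

------------------------------------------------------------------------
-- Sums over fillings

module FillingSums {c ℓ} (R : CommutativeRing c ℓ) where

  open CommutativeRing R renaming (refl to ≈-refl; sym to ≈-sym; trans to ≈-trans;
    _+_ to infixl 6 _⊕_; _*_ to infixl 7 _⊛_; _-_ to infixl 6 _⊖_; -_ to neg) hiding (zero)
  open Series rawRing using (∑)
  open FiniteSums R
  open import Relation.Binary.Reasoning.Setoid setoid
  open import Algebra.Properties.Semiring.Mult semiring
    using (×-congˡ; ×1-homo-*) renaming (_×_ to _·_)
  open import Algebra.Solver.Ring.NaturalCoefficients.Default commutativeSemiring
    using (solve; _:=_; _:*_)

  -- f depends on the relative order of the entries only.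
  Invariant : ∀ {n k} → (Array n k → Carrier) → Set ℓ
  Invariant f = ∀ {φ} → StrictlyMonotone φ → ∀ F → f (relabel φ F) ≈ f F

  ∑-𝓕-relabel : ∀ {φ} L n k (f : Array n k → Carrier) → StrictlyMonotone φ → Invariant f →
    ∑ (𝓕-over (map φ L) n k) f ≈ ∑ (𝓕-over L n k) f
  ∑-𝓕-relabel {φ} L n k f mono f-inv = begin
    ∑ (𝓕-over (map φ L) n k) f
      ≈⟨ ∑-filter (isFillingOver? (map φ L)) (vectorsOver (vectorsOver (map φ L) k) n) f ⟩
    ∑ (vectorsOver (vectorsOver (map φ L) k) n) (weight (map φ L))
      ≡⟨ cong (λ vs → ∑ (vectorsOver vs n) (weight (map φ L))) (vectorsOver-map φ L k) ⟩
    ∑ (vectorsOver (map (Vec.map φ) (vectorsOver L k)) n) (weight (map φ L))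
      ≡⟨ cong (λ vs → ∑ vs (weight (map φ L))) (vectorsOver-map (Vec.map φ) (vectorsOver L k) n) ⟩
    ∑ (map (relabel φ) (vectorsOver (vectorsOver L k) n)) (weight (map φ L))
      ≡⟨ ∑-map (relabel φ) (vectorsOver (vectorsOver L k) n) (weight (map φ L)) ⟩
    ∑ (vectorsOver (vectorsOver L k) n) (λ F → weight (map φ L) (relabel φ F))
      ≈⟨ ∑-cong (vectorsOver (vectorsOver L k) n) (λ {F} _ → weight-relabel F) ⟩
    ∑ (vectorsOver (vectorsOver L k) n) (weight L)
      ≈⟨ ∑-filter (isFillingOver? L) (vectorsOver (vectorsOver L k) n) f ⟨
    ∑ (𝓕-over L n k) f ∎
    where
    weight : List ℕ → Array n k → Carrier
    weight L F = if does (isFillingOver? L F) then f F else 0#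

    weight-relabel : ∀ F → weight (map φ L) (relabel φ F) ≈ weight L F
    weight-relabel F rewrite does-⇔ (isFillingOver-relabel {F = F} mono)
        (isFillingOver? (map φ L) (relabel φ F)) (isFillingOver? L F)
      with does (isFillingOver? L F)
    ... | true  = f-inv mono F
    ... | false = ≈-refl

  -- The sum of an invariant function over the fillings with entries S
  -- depends on the size of S only.  The 0 makes the elements of S positive,
  -- as needed to map 1, 2, … onto S by a strictly monotone map.
  ∑-𝓕-over : ∀ {S} n k (f : Array n k → Carrier) → AllPairs _<_ (0 ∷ S) → length S ≡ k * n →
    Invariant f → ∑ (𝓕-over S n k) f ≈ ∑ (𝓕 n k) f
  ∑-𝓕-over {S} n k f S-inc |S| f-inv = begin
    ∑ (𝓕-over S n k) f                              ≡⟨ cong (λ T → ∑ (𝓕-over T n k) f) (map-interpolate 0 S) ⟨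
    ∑ (𝓕-over (map φ [1… length S ]) n k) f         ≈⟨ ∑-𝓕-relabel [1… length S ] n k f (interpolate-mono S-inc) f-inv ⟩
    ∑ (𝓕-over [1… length S ] n k) f                 ≡⟨ cong (λ N → ∑ (𝓕-over [1… N ] n k) f) |S| ⟩
    ∑ (𝓕 n k) f                                     ∎
    where φ = interpolate 0 S

  ∑-const : ∀ (as : List A) r → ∑ as (λ _ → r) ≈ (length as · 1#) ⊛ r
  ∑-const []       r = ≈-sym (zeroˡ r)
  ∑-const (a ∷ as) r = ≈-sym (≈-trans (distribʳ r 1# (length as · 1#))
    (+-cong (*-identityˡ r) (≈-sym (∑-const as r))))

  module _ m n k (f : Array m k → Carrier) (g : Array n k → Carrier)
    (f-inv : Invariant f) (g-inv : Invariant g) where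

    ∑-𝓕-++ : ∀ h → (∀ G H → h (G Vec.++ H) ≈ f G ⊛ g H) →
      ∑ (𝓕 (m + n) k) h ≈ (((k * m + k * n) C (k * m)) · 1#) ⊛ (∑ (𝓕 m k) f ⊛ ∑ (𝓕 n k) g)
    ∑-𝓕-++ h h≈ = begin
      ∑ (𝓕 (m + n) k) h
        ≈⟨ ∑-↭ h (𝓕-over-++ m n k ([1…n]-unique (k * (m + n)))) ⟩
      ∑ (𝓕-split L m n k) h
        ≈⟨ ∑-concat-map _ (splits (k * m) L) h ⟩
      ∑ (splits (k * m) L) (λ (S , T) → ∑ (cartesianProductWith Vec._++_ (𝓕-over S m k) (𝓕-over T n k)) h)
        ≈⟨ ∑-cong (splits (k * m) L) (λ {(S , T)} → block S T) ⟩
      ∑ (splits (k * m) L) (λ _ → ∑ (𝓕 m k) f ⊛ ∑ (𝓕 n k) g)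
        ≈⟨ ∑-const (splits (k * m) L) _ ⟩
      (length (splits (k * m) L) · 1#) ⊛ (∑ (𝓕 m k) f ⊛ ∑ (𝓕 n k) g)
        ≈⟨ *-congʳ (×-congˡ (trans (length-splits (k * m) L)
             (cong (_C (k * m)) |L|))) ⟩
      (((k * m + k * n) C (k * m)) · 1#) ⊛ (∑ (𝓕 m k) f ⊛ ∑ (𝓕 n k) g) ∎
      where
      L = [1… k * (m + n) ]

      |L| : length L ≡ k * m + k * n
      |L| = trans (List.length-applyUpTo suc (k * (m + n))) (ℕ.*-distribˡ-+ k m n)

      block : ∀ S T → (S , T) ∈ splits (k * m) L →
        ∑ (cartesianProductWith Vec._++_ (𝓕-over S m k) (𝓕-over T n k)) h ≈ ∑ (𝓕 m k) f ⊛ ∑ (𝓕 n k) g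
      block S T ST∈ = begin
        ∑ (cartesianProductWith Vec._++_ (𝓕-over S m k) (𝓕-over T n k)) h
          ≈⟨ ∑-cartesianProductWith Vec._++_ (𝓕-over S m k) (𝓕-over T n k) h ⟩
        ∑ (𝓕-over S m k) (λ G → ∑ (𝓕-over T n k) (λ H → h (G Vec.++ H)))
          ≈⟨ ∑-cong (𝓕-over S m k) (λ {G} _ → ≈-trans
               (∑-cong (𝓕-over T n k) (λ {H} _ → h≈ G H)) (≈-sym (*-∑ (f G) (𝓕-over T n k) g))) ⟩
        ∑ (𝓕-over S m k) (λ G → f G ⊛ ∑ (𝓕-over T n k) g)
          ≈⟨ ∑-* (𝓕-over S m k) f _ ⟨
        ∑ (𝓕-over S m k) f ⊛ ∑ (𝓕-over T n k) g
          ≈⟨ *-cong (∑-𝓕-over m k f (increasing S⊆L) |S| f-inv) (∑-𝓕-over n k g (increasing T⊆L) |T| g-inv) ⟩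
        ∑ (𝓕 m k) f ⊛ ∑ (𝓕 n k) g ∎
        where
        sound = splits-sound (k * m) L ST∈
        S⊆L = proj₁ sound
        T⊆L = proj₁ (proj₂ sound)
        |S| = proj₂ (proj₂ (proj₂ sound))

        |T| : length T ≡ k * n
        |T| = ℕ.+-cancelˡ-≡ (k * m) (length T) (k * n) (trans (cong (_+ length T) (sym |S|))
          (trans (sym (List.length-++ S)) (trans (↭-length (proj₁ (proj₂ (proj₂ sound)))) |L|)))

        increasing : ∀ {S} → S ⊑ L → AllPairs _<_ (0 ∷ S)
        increasing S⊆L = AllPairs-resp-⊆ (refl ∷ S⊆L)
          ([1…n]-positive (k * (m + n)) ∷ [1…n]-increasing (k * (m + n)))

    -- With reciprocals of factorials as normalization, the sum over
    -- fillings of a juxtaposition becomes a product.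
    module _ (1/! : ℕ → Carrier) (!*1/! : ∀ m → ((m !) · 1#) ⊛ 1/! m ≈ 1#) where

      ∑-𝓕-++-normalized : ∀ h → (∀ G H → h (G Vec.++ H) ≈ f G ⊛ g H) →
        1/! (k * (m + n)) ⊛ ∑ (𝓕 (m + n) k) h ≈
        (1/! (k * m) ⊛ ∑ (𝓕 m k) f) ⊛ (1/! (k * n) ⊛ ∑ (𝓕 n k) g)
      ∑-𝓕-++-normalized h h≈ = begin
        1/! (k * (m + n)) ⊛ ∑ (𝓕 (m + n) k) h
          ≈⟨ *-cong (reflexive (cong 1/! (ℕ.*-distribˡ-+ k m n))) (∑-𝓕-++ h h≈) ⟩
        1/! (s + t) ⊛ (binomial ⊛ (∑f ⊛ ∑g))
          ≈⟨ *-identityʳ _ ⟨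
        1/! (s + t) ⊛ (binomial ⊛ (∑f ⊛ ∑g)) ⊛ 1#
          ≈⟨ *-congˡ (≈-trans (≈-sym (*-identityˡ 1#)) (*-cong (≈-sym (!*1/! s)) (≈-sym (!*1/! t)))) ⟩
        1/! (s + t) ⊛ (binomial ⊛ (∑f ⊛ ∑g)) ⊛ ((((s !) · 1#) ⊛ 1/! s) ⊛ (((t !) · 1#) ⊛ 1/! t))
          ≈⟨ solve 8 (λ a b u v p q p′ q′ →
               a :* (b :* (u :* v)) :* ((p :* q) :* (p′ :* q′)) := ((b :* (p :* p′)) :* a) :* ((q :* u) :* (q′ :* v)))
               ≈-refl (1/! (s + t)) binomial ∑f ∑g ((s !) · 1#) (1/! s) ((t !) · 1#) (1/! t) ⟩
        ((binomial ⊛ (((s !) · 1#) ⊛ ((t !) · 1#))) ⊛ 1/! (s + t)) ⊛ ((1/! s ⊛ ∑f) ⊛ (1/! t ⊛ ∑g))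
          ≈⟨ *-congʳ (*-congʳ factorial) ⟩
        ((((s + t) !) · 1#) ⊛ 1/! (s + t)) ⊛ ((1/! s ⊛ ∑f) ⊛ (1/! t ⊛ ∑g))
          ≈⟨ *-congʳ (!*1/! (s + t)) ⟩
        1# ⊛ ((1/! s ⊛ ∑f) ⊛ (1/! t ⊛ ∑g))
          ≈⟨ *-identityˡ _ ⟩
        (1/! s ⊛ ∑f) ⊛ (1/! t ⊛ ∑g) ∎
        where
        s = k * m
        t = k * n
        binomial = ((s + t) C s) · 1#
        ∑f = ∑ (𝓕 m k) f
        ∑g = ∑ (𝓕 n k) g

        factorial : binomial ⊛ (((s !) · 1#) ⊛ ((t !) · 1#)) ≈ ((s + t) !) · 1#
        factorial = begin
          binomial ⊛ (((s !) · 1#) ⊛ ((t !) · 1#))       ≈⟨ *-congˡ (×1-homo-* (s !) (t !)) ⟨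
          binomial ⊛ ((s ! * t !) · 1#)              ≈⟨ ×1-homo-* ((s + t) C s) (s ! * t !) ⟨
          (((s + t) C s) * (s ! * t !)) · 1#         ≡⟨ cong (_· 1#) (C*!*!≡! s t) ⟩
          ((s + t) !) · 1#                             ∎

------------------------------------------------------------------------
-- Fillings with one column

increasing-↭⇒≡ : ∀ {xs ys} → AllPairs _<_ xs → AllPairs _<_ ys → xs ↭ ys → xs ≡ ys
increasing-↭⇒≡ {[]}     {ys}     _ _ p = sym (↭-empty-inv (↭-sym p))
increasing-↭⇒≡ {x ∷ xs} {[]}     _ _ p = ↭-empty-inv p
increasing-↭⇒≡ {x ∷ xs} {y ∷ ys} (x< ∷ xs<) (y< ∷ ys<) p =
  heads (∈-resp-↭ p (here refl)) (∈-resp-↭ (↭-sym p) (here refl))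
  where
  sameHead : x ≡ y → x ∷ xs ≡ y ∷ ys
  sameHead refl = cong (x ∷_) (increasing-↭⇒≡ xs< ys< (drop-∷ p))

  heads : x ∈ y ∷ ys → y ∈ x ∷ xs → x ∷ xs ≡ y ∷ ys
  heads (here x≡y)   _            = sameHead x≡y
  heads (there _)    (here y≡x)   = sameHead (sym y≡x)
  heads (there x∈ys) (there y∈xs) = contradiction (All.lookup x< y∈xs) (ℕ.<-asym (All.lookup y< x∈ys))

Linked⇒AllPairs : ∀ {n} {c : Vec ℕ n} → Linked _<_ c → AllPairs _<_ (toList c)
Linked⇒AllPairs Linked.[]  = []
Linked⇒AllPairs Linked.[-] = [] ∷ []
Linked⇒AllPairs {c = v ∷ w ∷ c} (v<w Linked.∷ c-inc) with w<c ∷ c-pairs ← Linked⇒AllPairs c-inc =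
  (v<w ∷ All.map (ℕ.<-trans v<w) w<c) ∷ w<c ∷ c-pairs

-- The column c + 1, …, c + k.
consecutive : ℕ → ∀ k → Vec ℕ k
consecutive c zero    = []
consecutive c (suc k) = suc c ∷ consecutive (suc c) k

consecutive-linked : ∀ c k → Linked _<_ (consecutive c k)
consecutive-linked c zero          = Linked.[]
consecutive-linked c (suc zero)    = Linked.[-]
consecutive-linked c (suc (suc k)) = ℕ.n<1+n (suc c) Linked.∷ consecutive-linked (suc c) (suc k)

-- The function f stands for c + i, the shifts of which are not
-- definitionally of the same form.
toList-consecutive : ∀ f k → (∀ i → f (suc i) ≡ suc (f i)) → toList (consecutive (f 0) k) ≡ applyUpTo (suc ∘ f) k
toList-consecutive f zero    f-suc = refl
toList-consecutive f (suc k) f-suc = cong (suc (f 0) ∷_)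
  (trans (cong (λ c → toList (consecutive c k)) (sym (f-suc 0))) (toList-consecutive (f ∘ suc) k (f-suc ∘ suc)))

entries-column : ∀ {k} (c : Vec ℕ k) → entries (c ∷ []) ≡ toList c
entries-column c = trans (Vec.toList-++ c []) (List.++-identityʳ (toList c))

𝓕-one-column : ∀ k → 𝓕 1 k ↭ (consecutive 0 k ∷ []) ∷ []
𝓕-one-column k = unique∧sameElements⇒↭
  (𝓕-over-unique 1 k ([1…n]-unique (k * 1))) ([] ∷ []) to from
  where
  c₀ = consecutive 0 k

  c₀-filling : IsFillingOver [1… k * 1 ] (c₀ ∷ [])
  c₀-filling = ↭.↭-reflexive (trans (entries-column c₀)
      (trans (toList-consecutive id k (λ _ → refl)) (cong [1…_] (sym (ℕ.*-identityʳ k))))) ,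
    consecutive-linked 0 k VecAll.∷ VecAll.[]

  to : ∀ {F} → F ∈ 𝓕 1 k → F ∈ (c₀ ∷ []) ∷ []
  to {c ∷ []} F∈ with c↭ , c-inc VecAll.∷ VecAll.[] ← ∈-𝓕-over⁻ {[1… k * 1 ]} F∈ = here (cong (_∷ [])
    (trans (sym (Vec.cast-is-id refl c)) (Vec.toList-injective refl c c₀ (increasing-↭⇒≡
      (Linked⇒AllPairs c-inc) (Linked⇒AllPairs (consecutive-linked 0 k))
      (subst₂ _↭_ (entries-column c) (entries-column c₀) (↭-trans c↭ (↭-sym (proj₁ c₀-filling))))))))

  from : ∀ {F} → F ∈ (c₀ ∷ []) ∷ [] → F ∈ 𝓕 1 k
  from (here refl) = ∈-𝓕-over⁺ c₀-filling

------------------------------------------------------------------------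
-- Matches and the first columns of an array

module _ {k ℓ} (Υ : Pred (Array 2 k) ℓ) where

  open Equivalence

  matchAt-1 : ∀ {n} c d (F : Array n k) → MatchAt Υ (c ∷ d ∷ F) 1 ⇔ Υ (red (c ∷ d ∷ []))
  matchAt-1 c d F = mk⇔ (λ { (Fin.zero , _ , υ) → υ ; (Fin.suc _ , () , _) }) (λ υ → Fin.zero , refl , υ)

  matchAt-suc : ∀ {n} c (F : Array (suc n) k) i → MatchAt Υ (c ∷ F) (suc (suc i)) ⇔ MatchAt Υ F (suc i)
  matchAt-suc c (d ∷ F) i = mk⇔
    (λ { (Fin.suc p , eq , υ) → p , ℕ.suc-injective eq , υ })
    (λ (p , eq , υ) → Fin.suc p , cong suc eq , υ)

  matchAt-2 : ∀ {n} c d e (F : Array n k) → MatchAt Υ (c ∷ d ∷ e ∷ F) 2 ⇔ Υ (red (d ∷ e ∷ []))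
  matchAt-2 c d e F = matchAt-1 d e F ⇔-∘ matchAt-suc c (d ∷ e ∷ F) 0

  matchAt-2+ : ∀ {n} c d (F : Array (suc n) k) i → MatchAt Υ (c ∷ d ∷ F) (3 + i) ⇔ MatchAt Υ F (suc i)
  matchAt-2+ c d F i = matchAt-suc d F i ⇔-∘ matchAt-suc c (d ∷ F) (suc i)

  matchesAtAll-∷ : ∀ {n} c d (F : Array n k) →
    MatchesAtAll Υ (c ∷ d ∷ F) ⇔ (Υ (red (c ∷ d ∷ [])) × MatchesAtAll Υ (d ∷ F))
  matchesAtAll-∷ {n} c d F = mk⇔
    (λ { (m ∷ ms) → to (matchAt-1 c d F) m ,
      All.applyUpTo⁺₁ suc n (λ {i} i<n → to (matchAt-suc c (d ∷ F) i) (All.applyUpTo⁻ (suc ∘ suc) n ms i<n)) })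
    (λ (υ , ms) → from (matchAt-1 c d F) υ ∷
      All.applyUpTo⁺₁ (suc ∘ suc) n (λ {i} i<n → from (matchAt-suc c (d ∷ F) i) (All.applyUpTo⁻ suc n ms i<n)))

  odd-2+ : ∀ {i} → (¬ 2 ∣ 2 + i) ⇔ (¬ 2 ∣ i)
  odd-2+ = mk⇔ (_∘ ∣m∣n⇒∣m+n ∣-refl) (_∘ (λ p → ∣m+n∣m⇒∣n p ∣-refl))

  odd-1 : ¬ 2 ∣ 1
  odd-1 p = ℕ.<-irrefl refl (∣⇒≤ p)

  matchesAtOdd-2 : ∀ c d → MatchesAtOdd Υ (c ∷ d ∷ []) ⇔ Υ (red (c ∷ d ∷ []))
  matchesAtOdd-2 c d = mk⇔ (λ { (m ∷ []) → to (matchAt-1 c d []) (m odd-1) })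
    (λ υ → (λ _ → from (matchAt-1 c d []) υ) ∷ [])

  matchesAtOdd-∷∷ : ∀ {n} c d e (F : Array n k) →
    MatchesAtOdd Υ (c ∷ d ∷ e ∷ F) ⇔ (Υ (red (c ∷ d ∷ [])) × MatchesAtOdd Υ (e ∷ F))
  matchesAtOdd-∷∷ {n} c d e F = mk⇔
    (λ { (m ∷ _ ∷ ms) → to (matchAt-1 c d (e ∷ F)) (m odd-1) , All.applyUpTo⁺₁ suc n (λ {i} i<n odd →
      to (matchAt-2+ c d (e ∷ F) i) (All.applyUpTo⁻ (suc ∘ suc ∘ suc) n ms i<n (from odd-2+ odd))) })
    (λ (υ , ms) → (λ _ → from (matchAt-1 c d (e ∷ F)) υ) ∷ (λ ¬2∣2 → contradiction ∣-refl ¬2∣2) ∷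
      All.applyUpTo⁺₁ (suc ∘ suc ∘ suc) n (λ {i} i<n odd →
        from (matchAt-2+ c d (e ∷ F) i) (All.applyUpTo⁻ suc n ms i<n (to odd-2+ odd))))

count-applyUpTo : ∀ {p q} {P : Pred ℕ p} {Q : Pred ℕ q} (P? : Decidable P) (Q? : Decidable Q) g h m →
  (∀ i → P (g i) ⇔ Q (h i)) → length (filter P? (applyUpTo g m)) ≡ length (filter Q? (applyUpTo h m))
count-applyUpTo P? Q? g h zero    P⇔Q = refl
count-applyUpTo P? Q? g h (suc m) P⇔Q rewrite does-⇔ (P⇔Q 0) (P? (g 0)) (Q? (h 0)) with does (Q? (h 0))
... | true  = cong suc (count-applyUpTo P? Q? (g ∘ suc) (h ∘ suc) m (P⇔Q ∘ suc))
... | false = count-applyUpTo P? Q? (g ∘ suc) (h ∘ suc) m (P⇔Q ∘ suc)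

module _ {k ℓ} {Υ : Pred (Array 2 k) ℓ} (Υ? : Decidable Υ) where

  -- The number of i from 1 to m with a match at 2 i, so that mch⁽²⁾ F is the
  -- case where m is the number of columns.
  evenMatches : ∀ {n} → Array n k → ℕ → ℕ
  evenMatches F m = length (filter (λ i → matchAt? Υ? F (2 * i)) [1… m ])

  evenMatches-1 : ∀ c m → evenMatches (c ∷ []) m ≡ 0
  evenMatches-1 c m = cong length (List.filter-none (λ i → matchAt? Υ? (c ∷ []) (2 * i)) {[1… m ]}
    (All.applyUpTo⁺₂ suc m λ { i (() , _) }))

  evenMatches-2 : ∀ c d m → evenMatches (c ∷ d ∷ []) m ≡ 0
  evenMatches-2 c d m = cong length (List.filter-none (λ i → matchAt? Υ? (c ∷ d ∷ []) (2 * i)) {[1… m ]}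
    (All.applyUpTo⁺₂ suc m λ { i (Fin.zero , eq , _) → ℕ.m+1+n≢0 i (ℕ.suc-injective eq) }))

  2*i>2 : ∀ {n} c d e (F : Array n k) i →
    MatchAt Υ (c ∷ d ∷ e ∷ F) (2 * suc (suc i)) ⇔ MatchAt Υ (e ∷ F) (2 * suc i)
  2*i>2 c d e F i =
    subst (λ j → MatchAt Υ (c ∷ d ∷ e ∷ F) j ⇔ MatchAt Υ (e ∷ F) (2 * suc i)) (sym (ℕ.*-suc 2 (suc i)))
      (matchAt-2+ Υ c d (e ∷ F) (i + suc (i + 0)))

  evenMatches-∷∷ : ∀ {n} c d e (F : Array n k) m → evenMatches (c ∷ d ∷ e ∷ F) (suc m) ≡
    (if does (Υ? (red (d ∷ e ∷ []))) then 1 else 0) + evenMatches (e ∷ F) m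
  evenMatches-∷∷ {n} c d e F m
    rewrite does-⇔ (matchAt-2 Υ c d e F) (matchAt? Υ? (c ∷ d ∷ e ∷ F) 2) (Υ? (red (d ∷ e ∷ [])))
    with does (Υ? (red (d ∷ e ∷ [])))
  ... | true  = cong suc (count-applyUpTo (matchAt? Υ? (c ∷ d ∷ e ∷ F) ∘ (2 *_))
                  (matchAt? Υ? (e ∷ F) ∘ (2 *_)) (suc ∘ suc) suc m (2*i>2 c d e F))
  ... | false = count-applyUpTo (matchAt? Υ? (c ∷ d ∷ e ∷ F) ∘ (2 *_))
                  (matchAt? Υ? (e ∷ F) ∘ (2 *_)) (suc ∘ suc) suc m (2*i>2 c d e F)

------------------------------------------------------------------------
-- Weights of arrays and the recurrence for their sums

module Weights {c ℓ} (R : CommutativeRing c ℓ) (x : CommutativeRing.Carrier R)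
  {k ℓ′} {Υ : Pred (Array 2 k) ℓ′} (Υ? : Decidable Υ) where

  open CommutativeRing R renaming (refl to ≈-refl; sym to ≈-sym; trans to ≈-trans;
    _+_ to infixl 6 _⊕_; _*_ to infixl 7 _⊛_; _-_ to infixl 6 _⊖_; -_ to neg) hiding (zero)
  open RawSemiringDefs (RawRing.rawSemiring rawRing) using (_^_)
  open Series rawRing using (∑)
  open FiniteSums R
  open FillingSums R
  open import Relation.Binary.Reasoning.Setoid setoid
  open import Algebra.Properties.Semiring.Mult semiring using () renaming (_×_ to _·_)
  open import Algebra.Solver.Ring.NaturalCoefficients.Default commutativeSemiring
    using (solve; _:=_; _:*_; _:+_; con)

  -- Whether two adjacent columns c and d form a match.
  matches : Vec ℕ k → Vec ℕ k → Bool
  matches c d = does (Υ? (red (c ∷ d ∷ [])))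

  -- The indicator of a truth value.
  [_] : Bool → Carrier
  [ b ] = if b then 1# else 0#

  -- The weights are defined on lists of columns, for which cutting off an
  -- initial segment does not affect the type.

  -- The indicator of a match at every position.
  fullWeight : List (Vec ℕ k) → Carrier
  fullWeight []           = 1#
  fullWeight (c ∷ [])     = 1#
  fullWeight (c ∷ d ∷ cs) = [ matches c d ] ⊛ fullWeight (d ∷ cs)

  -- The product of the indicators of a match at the odd positions and of a
  -- factor x for each match at an even position.
  oddWeight : List (Vec ℕ k) → Carrier
  oddWeight []               = 1#
  oddWeight (c ∷ [])         = 1#
  oddWeight (c ∷ d ∷ [])     = [ matches c d ]
  oddWeight (c ∷ d ∷ e ∷ cs) =
    [ matches c d ] ⊛ ((if matches d e then x else 1#) ⊛ oddWeight (e ∷ cs))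

  private y = x ⊖ 1#

  -- The identity x ^ b = 1 + (x - 1) b for b = 0, 1.
  x^b : ∀ b → (if b then x else 1#) ≈ 1# ⊕ y ⊛ [ b ]
  x^b true  = ≈-sym (begin
    1# ⊕ (x ⊖ 1#) ⊛ 1#     ≈⟨ +-congˡ (*-identityʳ y) ⟩
    1# ⊕ (x ⊖ 1#)          ≈⟨ +-comm 1# y ⟩
    x ⊖ 1# ⊕ 1#            ≈⟨ +-assoc x (neg 1#) 1# ⟩
    x ⊕ (neg 1# ⊕ 1#)      ≈⟨ +-congˡ (-‿inverseˡ 1#) ⟩
    x ⊕ 0#                 ≈⟨ +-identityʳ x ⟩
    x                      ∎)
  x^b false = ≈-sym (≈-trans (+-congˡ (zeroʳ y)) (+-identityʳ 1#))

  -- The summand i stands for the factor 1 at position 2 i + 2, after a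
  -- factor x - 1 at each of the even positions before it; the term outside
  -- of the sum has a factor x - 1 at all even positions.
  oddWeight-expand : ∀ n cs → length cs ≡ suc (2 * n) →
    oddWeight cs ≈ y ^ n ⊛ fullWeight cs ⊕
      ∑ (upTo n) (λ i → y ^ i ⊛
        (fullWeight (List.take (2 * suc i) cs) ⊛ oddWeight (List.drop (2 * suc i) cs)))
  oddWeight-expand zero (c ∷ []) _ = ≈-sym (≈-trans (+-identityʳ _) (*-identityˡ 1#))
  oddWeight-expand (suc n) cs |cs| = expand cs (trans |cs| (cong suc (ℕ.*-suc 2 n)))
    where
    term : List (Vec ℕ k) → ℕ → Carrier
    term cs i = fullWeight (List.take (2 * suc i) cs) ⊛ oddWeight (List.drop (2 * suc i) cs)

    expand : ∀ cs → length cs ≡ suc (2 + 2 * n) →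
      oddWeight cs ≈ y ^ suc n ⊛ fullWeight cs ⊕ ∑ (upTo (suc n)) (λ i → y ^ i ⊛ term cs i)
    expand (c ∷ d ∷ e ∷ cs) |cs| = begin
      p ⊛ ((if matches d e then x else 1#) ⊛ W)
        ≈⟨ *-congˡ (*-congʳ (x^b (matches d e))) ⟩
      p ⊛ ((1# ⊕ y ⊛ q) ⊛ W)
        ≈⟨ solve 4 (λ p y q w → p :* ((con 1 :+ y :* q) :* w) := p :* w :+ (y :* (p :* q)) :* w) ≈-refl p y q W ⟩
      p ⊛ W ⊕ (y ⊛ (p ⊛ q)) ⊛ W
        ≈⟨ +-congˡ (*-congˡ (oddWeight-expand n (e ∷ cs) (ℕ.suc-injective (ℕ.suc-injective |cs|)))) ⟩
      p ⊛ W ⊕ (y ⊛ (p ⊛ q)) ⊛ (y ^ n ⊛ V ⊕ S)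
        ≈⟨ solve 7 (λ p q y w z v s → p :* w :+ (y :* (p :* q)) :* (z :* v :+ s) :=
             (y :* z) :* (p :* (q :* v)) :+ (con 1 :* ((p :* con 1) :* w) :+ (y :* (p :* q)) :* s)) ≈-refl
             p q y W (y ^ n) V S ⟩
      y ^ suc n ⊛ (p ⊛ (q ⊛ V)) ⊕ (y ^ 0 ⊛ term all 0 ⊕ (y ⊛ (p ⊛ q)) ⊛ S)
        ≈⟨ +-congˡ (+-congˡ (≈-trans (*-∑ _ (upTo n) _) (∑-cong (upTo n) (λ {i} _ → later i)))) ⟩
      y ^ suc n ⊛ fullWeight all ⊕ (y ^ 0 ⊛ term all 0 ⊕ ∑ (upTo n) (λ i → y ^ suc i ⊛ term all (suc i)))
        ≡⟨ cong (y ^ suc n ⊛ fullWeight all ⊕_) (∑-upTo-suc n (λ i → y ^ i ⊛ term all i)) ⟨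
      y ^ suc n ⊛ fullWeight all ⊕ ∑ (upTo (suc n)) (λ i → y ^ i ⊛ term all i) ∎
      where
      all = c ∷ d ∷ e ∷ cs
      p = [ matches c d ]
      q = [ matches d e ]
      W = oddWeight (e ∷ cs)
      V = fullWeight (e ∷ cs)
      S = ∑ (upTo n) (λ i → y ^ i ⊛ term (e ∷ cs) i)

      later : ∀ i → (y ⊛ (p ⊛ q)) ⊛ (y ^ i ⊛ term (e ∷ cs) i) ≈ y ^ suc i ⊛ term all (suc i)
      later i = begin
        (y ⊛ (p ⊛ q)) ⊛ (y ^ i ⊛ (f ⊛ g))
          ≈⟨ solve 6 (λ y p q z f g → (y :* (p :* q)) :* (z :* (f :* g)) := (y :* z) :* ((p :* (q :* f)) :* g))
               ≈-refl y p q (y ^ i) f g ⟩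
        y ^ suc i ⊛ (fullWeight (List.take (2 + 2 * suc i) all) ⊛ oddWeight (List.drop (2 + 2 * suc i) all))
          ≡⟨ cong (λ j → y ^ suc i ⊛ (fullWeight (List.take j all) ⊛ oddWeight (List.drop j all)))
               (ℕ.*-suc 2 (suc i)) ⟨
        y ^ suc i ⊛ term all (suc i) ∎
        where
        f = fullWeight (List.take (2 * suc i) (e ∷ cs))
        g = oddWeight (List.drop (2 * suc i) (e ∷ cs))

  matches-relabel : ∀ {φ} → StrictlyMonotone φ → ∀ c d → matches (Vec.map φ c) (Vec.map φ d) ≡ matches c d
  matches-relabel mono c d = cong (does ∘ Υ?) (red-relabel mono (c ∷ d ∷ []))

  fullWeight-relabel : ∀ {φ} → StrictlyMonotone φ → ∀ cs → fullWeight (map (Vec.map φ) cs) ≡ fullWeight cs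
  fullWeight-relabel mono []           = refl
  fullWeight-relabel mono (c ∷ [])     = refl
  fullWeight-relabel mono (c ∷ d ∷ cs) =
    cong₂ (λ b w → [ b ] ⊛ w) (matches-relabel mono c d) (fullWeight-relabel mono (d ∷ cs))

  oddWeight-relabel : ∀ {φ} → StrictlyMonotone φ → ∀ cs → oddWeight (map (Vec.map φ) cs) ≡ oddWeight cs
  oddWeight-relabel mono []           = refl
  oddWeight-relabel mono (c ∷ [])     = refl
  oddWeight-relabel mono (c ∷ d ∷ []) = cong [_] (matches-relabel mono c d)
  oddWeight-relabel mono (c ∷ d ∷ e ∷ cs) = cong₂ _⊛_ (cong [_] (matches-relabel mono c d))
    (cong₂ (λ b w → (if b then x else 1#) ⊛ w) (matches-relabel mono d e) (oddWeight-relabel mono (e ∷ cs)))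

  -- A weight of lists of columns, as a function on arrays.
  onArrays : (List (Vec ℕ k) → Carrier) → ∀ {n} → Array n k → Carrier
  onArrays w F = w (toList F)

  onArrays-invariant : ∀ {w n} → (∀ {φ} → StrictlyMonotone φ → ∀ cs → w (map (Vec.map φ) cs) ≡ w cs) →
    Invariant {n} (onArrays w)
  onArrays-invariant {w} w-inv {φ} mono F =
    reflexive (trans (cong w (Vec.toList-map (Vec.map φ) F)) (w-inv mono (toList F)))

  [∧] : ∀ a b → [ a ∧ b ] ≈ [ a ] ⊛ [ b ]
  [∧] true  b = ≈-sym (*-identityˡ [ b ])
  [∧] false b = ≈-sym (zeroˡ [ b ])

  [matchesAtAll] : ∀ {n} (F : Array (suc n) k) → [ does (matchesAtAll? Υ? F) ] ≈ fullWeight (toList F)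
  [matchesAtAll] (c ∷ [])     = ≈-refl
  [matchesAtAll] (c ∷ d ∷ F) = begin
    [ does (matchesAtAll? Υ? (c ∷ d ∷ F)) ]
      ≡⟨ cong [_] (does-⇔ (matchesAtAll-∷ Υ c d F) (matchesAtAll? Υ? (c ∷ d ∷ F))
           (Υ? (red (c ∷ d ∷ [])) ×-dec matchesAtAll? Υ? (d ∷ F))) ⟩
    [ matches c d ∧ does (matchesAtAll? Υ? (d ∷ F)) ]
      ≈⟨ [∧] (matches c d) _ ⟩
    [ matches c d ] ⊛ [ does (matchesAtAll? Υ? (d ∷ F)) ]
      ≈⟨ *-congˡ ([matchesAtAll] (d ∷ F)) ⟩
    [ matches c d ] ⊛ fullWeight (toList (d ∷ F)) ∎

  ∑-full : ∀ n → length (filter (matchesAtAll? Υ?) (𝓕 (suc n) k)) · 1# ≈ ∑ (𝓕 (suc n) k) (onArrays fullWeight)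
  ∑-full n = begin
    length (filter (matchesAtAll? Υ?) (𝓕 (suc n) k)) · 1#        ≈⟨ *-identityʳ _ ⟨
    (length (filter (matchesAtAll? Υ?) (𝓕 (suc n) k)) · 1#) ⊛ 1# ≈⟨ ∑-const (filter (matchesAtAll? Υ?) (𝓕 (suc n) k)) 1# ⟨
    ∑ (filter (matchesAtAll? Υ?) (𝓕 (suc n) k)) (λ _ → 1#)       ≈⟨ ∑-filter (matchesAtAll? Υ?) (𝓕 (suc n) k) (λ _ → 1#) ⟩
    ∑ (𝓕 (suc n) k) (λ F → [ does (matchesAtAll? Υ? F) ])        ≈⟨ ∑-cong (𝓕 (suc n) k) (λ {F} _ → [matchesAtAll] F) ⟩
    ∑ (𝓕 (suc n) k) (onArrays fullWeight)                        ∎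

  -- The conventional value 1 of full at 1 agrees with the number of fillings
  -- of one column.
  full≈∑ : ∀ n → full Υ? (suc n) · 1# ≈ ∑ (𝓕 (suc n) k) (onArrays fullWeight)
  full≈∑ zero    = ≈-sym (∑-↭ {as = 𝓕 1 k} (onArrays fullWeight) (𝓕-one-column k))
  full≈∑ (suc n) = ∑-full (suc n)

  -- The bound m on the positions counted is kept general for the induction,
  -- which removes two columns but lowers the bound by 1.
  oddWeight-evenMatches : ∀ {n} (F : Array (suc n) k) m → suc n ≤ m →
    (if does (matchesAtOdd? Υ? F) then x ^ evenMatches Υ? F m else 0#) ≈ oddWeight (toList F)
  oddWeight-evenMatches (c ∷ []) m _ = reflexive (cong (x ^_) (evenMatches-1 Υ? c m))
  oddWeight-evenMatches (c ∷ d ∷ []) m _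
    rewrite does-⇔ (matchesAtOdd-2 Υ c d) (matchesAtOdd? Υ? (c ∷ d ∷ [])) (Υ? (red (c ∷ d ∷ [])))
          | evenMatches-2 Υ? c d m = ≈-refl
  oddWeight-evenMatches (c ∷ d ∷ e ∷ F) (suc m) (s≤s n<m)
    rewrite does-⇔ (matchesAtOdd-∷∷ Υ c d e F) (matchesAtOdd? Υ? (c ∷ d ∷ e ∷ F))
              (Υ? (red (c ∷ d ∷ [])) ×-dec matchesAtOdd? Υ? (e ∷ F))
          | evenMatches-∷∷ Υ? c d e F m
    with matches c d | matches d e | oddWeight-evenMatches (e ∷ F) m (ℕ.≤-trans (ℕ.n≤1+n _) n<m)
  ... | false | _     | _  = ≈-sym (zeroˡ _)
  ... | true  | true  | ih = ≈-sym (≈-trans (*-identityˡ _) (≈-trans (*-congˡ (≈-sym ih))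
    (times-x (does (matchesAtOdd? Υ? (e ∷ F))) (evenMatches Υ? (e ∷ F) m))))
    where
    times-x : ∀ b m → x ⊛ (if b then x ^ m else 0#) ≈ (if b then x ^ suc m else 0#)
    times-x true  m = ≈-refl
    times-x false m = zeroʳ x
  ... | true  | false | ih = ≈-sym (≈-trans (*-identityˡ _) (≈-trans (*-identityˡ _) (≈-sym ih)))

  ∑-𝓕⁽²⁾ : ∀ n → ∑ (𝓕⁽²⁾ Υ? (suc n)) (λ F → x ^ mch⁽²⁾ Υ? F) ≈ ∑ (𝓕 (suc n) k) (onArrays oddWeight)
  ∑-𝓕⁽²⁾ n = ≈-trans (∑-filter (matchesAtOdd? Υ?) (𝓕 (suc n) k) (λ F → x ^ mch⁽²⁾ Υ? F))
    (∑-cong (𝓕 (suc n) k) (λ {F} _ → oddWeight-evenMatches F (suc n) ℕ.≤-refl))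

  module _ (1/! : ℕ → Carrier) (!*1/! : ∀ m → ((m !) · 1#) ⊛ 1/! m ≈ 1#) where

    -- The normalized sums of the weights over the fillings with N columns.
    oddSum : ℕ → Carrier
    oddSum N = 1/! (k * N) ⊛ ∑ (𝓕 N k) (onArrays oddWeight)

    fullSum : ℕ → Carrier
    fullSum N = 1/! (k * N) ⊛ ∑ (𝓕 N k) (onArrays fullWeight)

    ∑-block : ∀ {N} m n → N ≡ m + n →
      1/! (k * N) ⊛ ∑ (𝓕 N k) (onArrays (λ cs → fullWeight (List.take m cs) ⊛ oddWeight (List.drop m cs))) ≈
      fullSum m ⊛ oddSum n
    ∑-block m n refl = ∑-𝓕-++-normalized m n k (onArrays fullWeight) (onArrays oddWeight)
      (onArrays-invariant fullWeight-relabel) (onArrays-invariant oddWeight-relabel) 1/! !*1/! _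
      (λ G H → reflexive (cong₂ _⊛_ (cong fullWeight (take-++ G H)) (cong oddWeight (drop-++ G H))))
      where
      take-++ : ∀ {m n} (G : Array m k) (H : Array n k) → List.take m (toList (G Vec.++ H)) ≡ toList G
      take-++ []      H = refl
      take-++ (c ∷ G) H = cong (c ∷_) (take-++ G H)

      drop-++ : ∀ {m n} (G : Array m k) (H : Array n k) → List.drop m (toList (G Vec.++ H)) ≡ toList H
      drop-++ []      H = refl
      drop-++ (c ∷ G) H = drop-++ G H

    oddSum-recurrence : ∀ n → oddSum (suc (2 * n)) ≈ y ^ n ⊛ fullSum (suc (2 * n)) ⊕
      ∑ (upTo n) (λ i → y ^ i ⊛ fullSum (2 * suc i) ⊛ oddSum (suc (2 * (n ∸ suc i))))
    oddSum-recurrence n = begin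
      u ⊛ ∑ (𝓕 N k) (onArrays oddWeight)
        ≈⟨ *-congˡ (∑-cong (𝓕 N k) (λ {F} _ → oddWeight-expand n (toList F) (Vec.length-toList F))) ⟩
      u ⊛ ∑ (𝓕 N k) (λ F → y ^ n ⊛ fullWeight (toList F) ⊕ ∑ (upTo n) (λ i → y ^ i ⊛ block i F))
        ≈⟨ *-congˡ (∑-+ (𝓕 N k) _ _) ⟩
      u ⊛ (∑ (𝓕 N k) (λ F → y ^ n ⊛ fullWeight (toList F)) ⊕ ∑ (𝓕 N k) (λ F → ∑ (upTo n) (λ i → y ^ i ⊛ block i F)))
        ≈⟨ *-congˡ (+-cong (≈-sym (*-∑ (y ^ n) (𝓕 N k) (onArrays fullWeight))) (∑-swap (𝓕 N k) (upTo n) _)) ⟩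
      u ⊛ (y ^ n ⊛ V ⊕ ∑ (upTo n) (λ i → ∑ (𝓕 N k) (λ F → y ^ i ⊛ block i F)))
        ≈⟨ solve 4 (λ u z b s → u :* (z :* b :+ s) := z :* (u :* b) :+ u :* s) ≈-refl u (y ^ n) V _ ⟩
      y ^ n ⊛ (u ⊛ V) ⊕ u ⊛ ∑ (upTo n) (λ i → ∑ (𝓕 N k) (λ F → y ^ i ⊛ block i F))
        ≈⟨ +-congˡ (≈-trans (*-∑ u (upTo n) _) (∑-cong (upTo n) (λ {i} i∈ → summand i (∈-upTo⁻ i∈)))) ⟩
      y ^ n ⊛ fullSum N ⊕ ∑ (upTo n) (λ i → y ^ i ⊛ fullSum (2 * suc i) ⊛ oddSum (suc (2 * (n ∸ suc i)))) ∎
      where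
      N = suc (2 * n)
      u = 1/! (k * N)
      V = ∑ (𝓕 N k) (onArrays fullWeight)

      block : ℕ → Array N k → Carrier
      block i = onArrays (λ cs → fullWeight (List.take (2 * suc i) cs) ⊛ oddWeight (List.drop (2 * suc i) cs))

      columns : ∀ i → i < n → N ≡ 2 * suc i + suc (2 * (n ∸ suc i))
      columns i i<n = sym (trans (ℕ.+-suc (2 * suc i) _) (cong suc
        (trans (sym (ℕ.*-distribˡ-+ 2 (suc i) (n ∸ suc i))) (cong (2 *_) (ℕ.m+[n∸m]≡n i<n)))))

      summand : ∀ i → i < n → u ⊛ ∑ (𝓕 N k) (λ F → y ^ i ⊛ block i F) ≈
        y ^ i ⊛ fullSum (2 * suc i) ⊛ oddSum (suc (2 * (n ∸ suc i)))
      summand i i<n = begin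
        u ⊛ ∑ (𝓕 N k) (λ F → y ^ i ⊛ block i F)   ≈⟨ *-congˡ (*-∑ (y ^ i) (𝓕 N k) (block i)) ⟨
        u ⊛ (y ^ i ⊛ ∑ (𝓕 N k) (block i))          ≈⟨ solve 3 (λ u z s → u :* (z :* s) := z :* (u :* s)) ≈-refl u (y ^ i) _ ⟩
        y ^ i ⊛ (u ⊛ ∑ (𝓕 N k) (block i))          ≈⟨ *-congˡ (∑-block (2 * suc i) (suc (2 * (n ∸ suc i))) (columns i i<n)) ⟩
        y ^ i ⊛ (fullSum (2 * suc i) ⊛ oddSum (suc (2 * (n ∸ suc i))))   ≈⟨ *-assoc _ _ _ ⟨
        y ^ i ⊛ fullSum (2 * suc i) ⊛ oddSum (suc (2 * (n ∸ suc i)))     ∎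

------------------------------------------------------------------------
-- Series in odd and even powers of t

evenOrOdd : ∀ N → (∃ λ n → N ≡ 2 * n) ⊎ (∃ λ n → N ≡ suc (2 * n))
evenOrOdd zero    = inj₁ (0 , refl)
evenOrOdd (suc N) with evenOrOdd N
... | inj₁ (n , eq) = inj₂ (n , cong suc eq)
... | inj₂ (n , eq) = inj₁ (suc n , trans (cong suc eq) (sym (ℕ.*-suc 2 n)))

2*suc-∸1 : ∀ n → 2 * suc n ∸ 1 ≡ suc (2 * n)
2*suc-∸1 n = ℕ.+-suc n (n + 0)

module ParitySeries {c ℓ} (R : CommutativeRing c ℓ) where

  open CommutativeRing R renaming (refl to ≈-refl; sym to ≈-sym; trans to ≈-trans;
    _+_ to infixl 6 _⊕_; _*_ to infixl 7 _⊛_; _-_ to infixl 6 _⊖_; -_ to neg) hiding (zero)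
  open Series rawRing renaming (Series to PowerSeries)
  open FiniteSums R
  open SeriesRing R
  open import Relation.Binary.Reasoning.Setoid setoid

  ∑-single : ∀ {as : List A} {m} f → Unique as → m ∈ as → (∀ {a} → a ≢ m → f a ≈ 0#) → ∑ as f ≈ f m
  ∑-single {as = a ∷ as} f (a∉as ∷ _) (here refl) f≈0 = ≈-trans
    (+-congˡ (∑-zero as (λ b∈as → f≈0 (λ b≡a → All.lookup a∉as b∈as (sym b≡a))))) (+-identityʳ (f a))
  ∑-single {as = a ∷ as} f (a∉as ∷ as!) (there m∈as) f≈0 = ≈-trans
    (+-cong (f≈0 (All.lookup a∉as m∈as)) (∑-single f as! m∈as f≈0)) (+-identityˡ _)

  ·t^-at : ∀ r {e N} → e ≡ N → (r ·t^ e) N ≡ r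
  ·t^-at r {e} {N} e≡N = cong (if_then r else 0#) (dec-true (e ℕ.≟ N) e≡N)

  ·t^-off : ∀ r {e N} → e ≢ N → (r ·t^ e) N ≡ 0#
  ·t^-off r {e} {N} e≢N = cong (if_then r else 0#) (dec-false (e ℕ.≟ N) e≢N)

  module _ (coefficient : ℕ → Carrier) where

    -- The series with the given coefficients at t, t ^ 3, t ^ 5, … and at
    -- t ^ 2, t ^ 4, t ^ 6, …, the first coefficient used being that at 1.
    oddSeries evenSeries : PowerSeries
    oddSeries  = ∑ₙ≥₁ λ n → coefficient n ·t^ (2 * n ∸ 1)
    evenSeries = ∑ₙ≥₁ λ n → coefficient n ·t^ (2 * n)

    private
      n∈[1…N] : ∀ {n N} → n < N → suc n ∈ [1… N ]
      n∈[1…N] n<N = ∈-applyUpTo⁺ suc n<N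

      positive : ∀ {n N} → n ∈ [1… N ] → ∃ λ m → n ≡ suc m
      positive n∈ with i , _ , eq ← ∈-applyUpTo⁻ suc n∈ = i , eq

    oddSeries-odd : ∀ n → oddSeries (suc (2 * n)) ≈ coefficient (suc n)
    oddSeries-odd n = begin
      oddSeries (suc (2 * n))
        ≈⟨ ∑-single _ ([1…n]-unique (suc (2 * n))) (n∈[1…N] (s≤s (ℕ.m≤m+n n (n + 0))))
             (λ {m} m≢ → reflexive (·t^-off (coefficient m) (m≢ ∘ injective m))) ⟩
      (coefficient (suc n) ·t^ (2 * suc n ∸ 1)) (suc (2 * n))
        ≡⟨ ·t^-at (coefficient (suc n)) (2*suc-∸1 n) ⟩
      coefficient (suc n) ∎
      where
      injective : ∀ m → 2 * m ∸ 1 ≡ suc (2 * n) → m ≡ suc n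
      injective (suc m) eq = cong suc (ℕ.*-cancelˡ-≡ m n 2 (ℕ.suc-injective (trans (sym (2*suc-∸1 m)) eq)))

    oddSeries-even : ∀ n → oddSeries (2 * n) ≈ 0#
    oddSeries-even n = ∑-zero [1… 2 * n ] λ {m} m∈ → reflexive (·t^-off (coefficient m) (off (positive m∈)))
      where
      off : ∀ {m} → (∃ λ i → m ≡ suc i) → 2 * m ∸ 1 ≢ 2 * n
      off (i , refl) eq = ℕ.even≢odd n i (sym (trans (sym (2*suc-∸1 i)) eq))

    evenSeries-even : ∀ n → evenSeries (2 * suc n) ≈ coefficient (suc n)
    evenSeries-even n = begin
      evenSeries (2 * suc n)
        ≈⟨ ∑-single _ ([1…n]-unique (2 * suc n)) (n∈[1…N] (s≤s (ℕ.m≤m+n n (suc (n + 0)))))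
             (λ {m} m≢ → reflexive (·t^-off (coefficient m) (m≢ ∘ ℕ.*-cancelˡ-≡ m (suc n) 2))) ⟩
      (coefficient (suc n) ·t^ (2 * suc n)) (2 * suc n)
        ≡⟨ ·t^-at (coefficient (suc n)) {2 * suc n} refl ⟩
      coefficient (suc n) ∎

    evenSeries-odd : ∀ n → evenSeries (suc (2 * n)) ≈ 0#
    evenSeries-odd n = ∑-zero [1… suc (2 * n) ] λ {m} _ →
      reflexive (·t^-off (coefficient m) (ℕ.even≢odd m n))

  *ₛ-even : ∀ f g → (∀ n → f (suc (2 * n)) ≈ 0#) → (∀ n → g (2 * n) ≈ 0#) → ∀ n → (f *ₛ g) (2 * n) ≈ 0#
  *ₛ-even f g f-odd g-even n = ∑-zero (upTo (suc (2 * n))) λ {i} _ → vanish i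
    where
    vanish : ∀ i → f i ⊛ g (2 * n ∸ i) ≈ 0#
    vanish i with evenOrOdd i
    ... | inj₁ (j , refl) = ≈-trans
      (*-congˡ (≈-trans (reflexive (cong g (sym (ℕ.*-distribˡ-∸ 2 n j)))) (g-even (n ∸ j)))) (zeroʳ _)
    ... | inj₂ (j , refl) = ≈-trans (*-congʳ (f-odd j)) (zeroˡ _)

  -- If f is even, then the odd part of f g involves the odd part of g only.
  *ₛ-odd : ∀ f g → (∀ n → f (suc (2 * n)) ≈ 0#) → ∀ n →
    (f *ₛ g) (suc (2 * n)) ≈ ((λ j → f (2 * j)) *ₛ (λ j → g (suc (2 * j)))) n
  *ₛ-odd f g f-odd zero = begin
    (f *ₛ g) 1                            ≈⟨ *ₛ-sucᵉ f g 0 ⟩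
    f 0 ⊛ g 1 ⊕ ((f ∘ suc) *ₛ g) 0        ≈⟨ +-congˡ (≈-trans (*ₛ-0 (f ∘ suc) g) (≈-trans (*-congʳ (f-odd 0)) (zeroˡ _))) ⟩
    f 0 ⊛ g 1 ⊕ 0#                        ≡⟨⟩
    ((λ j → f (2 * j)) *ₛ (λ j → g (suc (2 * j)))) 0 ∎
  *ₛ-odd f g f-odd (suc n) = begin
    (f *ₛ g) (suc (2 * suc n))
      ≡⟨ cong (λ N → (f *ₛ g) (suc N)) (ℕ.*-suc 2 n) ⟩
    (f *ₛ g) (3 + 2 * n)
      ≈⟨ *ₛ-sucᵉ f g (2 + 2 * n) ⟩
    f 0 ⊛ g (3 + 2 * n) ⊕ ((f ∘ suc) *ₛ g) (2 + 2 * n)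
      ≈⟨ +-congˡ (*ₛ-sucᵉ (f ∘ suc) g (1 + 2 * n)) ⟩
    f 0 ⊛ g (3 + 2 * n) ⊕ (f 1 ⊛ g (2 + 2 * n) ⊕ (f″ *ₛ g) (1 + 2 * n))
      ≈⟨ +-congˡ (≈-trans (+-congʳ (≈-trans (*-congʳ (f-odd 0)) (zeroˡ _))) (+-identityˡ _)) ⟩
    f 0 ⊛ g (3 + 2 * n) ⊕ (f″ *ₛ g) (1 + 2 * n)
      ≈⟨ +-congˡ (*ₛ-odd f″ g (λ j → ≈-trans (reflexive (cong (f ∘ suc) (sym (ℕ.*-suc 2 j)))) (f-odd (suc j))) n) ⟩
    f 0 ⊛ g (3 + 2 * n) ⊕ ((λ j → f (2 + 2 * j)) *ₛ (λ j → g (suc (2 * j)))) n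
      ≈⟨ +-cong (*-congˡ (reflexive (cong (g ∘ suc) (sym (ℕ.*-suc 2 n)))))
           (*ₛ-cong {f = λ j → f (2 + 2 * j)} {g = λ j → g (suc (2 * j))}
             (λ j → reflexive (cong f (sym (ℕ.*-suc 2 j)))) (λ _ → ≈-refl) n) ⟩
    f 0 ⊛ g (suc (2 * suc n)) ⊕ ((λ j → f (2 * suc j)) *ₛ (λ j → g (suc (2 * j)))) n
      ≈⟨ *ₛ-sucᵉ (λ j → f (2 * j)) (λ j → g (suc (2 * j))) n ⟨
    ((λ j → f (2 * j)) *ₛ (λ j → g (suc (2 * j)))) (suc n) ∎
    where f″ = f ∘ suc ∘ suc

  recurrence⇒÷ : ∀ p h e →
    (∀ n → p (suc n) ≈ h (suc n) ⊕ ∑ (upTo n) (λ i → e (suc i) ⊛ p (suc (n ∸ suc i)))) →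
    oddSeries p ≈ₛ oddSeries h ÷ (1ₛ -ₛ evenSeries e)
  recurrence⇒÷ p h e p-rec = fixedPoint⇒÷ E ≈-refl fixedPoint
    where
    P = oddSeries p
    E = evenSeries e

    fixedPoint : P ≈ₛ oddSeries h +ₛ E *ₛ P
    fixedPoint N with evenOrOdd N
    ... | inj₁ (n , refl) = begin
      P (2 * n)                             ≈⟨ oddSeries-even p n ⟩
      0#                                    ≈⟨ +-identityˡ 0# ⟨
      0# ⊕ 0#                               ≈⟨ +-cong (oddSeries-even h n)
                                                 (*ₛ-even E P (evenSeries-odd e) (oddSeries-even p) n) ⟨
      oddSeries h (2 * n) ⊕ (E *ₛ P) (2 * n) ∎
    ... | inj₂ (n , refl) = begin
      P (suc (2 * n))
        ≈⟨ oddSeries-odd p n ⟩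
      p (suc n)
        ≈⟨ p-rec n ⟩
      h (suc n) ⊕ ∑ (upTo n) (λ i → e (suc i) ⊛ p (suc (n ∸ suc i)))
        ≈⟨ +-cong (oddSeries-odd h n) (∑-cong (upTo n) (λ {i} _ →
             *-cong (evenSeries-even e i) (oddSeries-odd p (n ∸ suc i)))) ⟨
      oddSeries h (suc (2 * n)) ⊕ ∑ (upTo n) (λ i → E (2 * suc i) ⊛ P (suc (2 * (n ∸ suc i))))
        ≈⟨ +-congˡ (≈-trans (+-congʳ (zeroˡ _)) (+-identityˡ _)) ⟨
      oddSeries h (suc (2 * n)) ⊕ (E 0 ⊛ P (suc (2 * n)) ⊕ ∑ (upTo n) (λ i → E (2 * suc i) ⊛ P (suc (2 * (n ∸ suc i)))))
        ≡⟨ cong (oddSeries h (suc (2 * n)) ⊕_) (∑-upTo-suc n (λ i → E (2 * i) ⊛ P (suc (2 * (n ∸ i))))) ⟨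
      oddSeries h (suc (2 * n)) ⊕ ((λ j → E (2 * j)) *ₛ (λ j → P (suc (2 * j)))) n
        ≈⟨ +-congˡ (*ₛ-odd E P (evenSeries-odd e) n) ⟨
      oddSeries h (suc (2 * n)) ⊕ (E *ₛ P) (suc (2 * n)) ∎

------------------------------------------------------------------------
-- The generating function over an arbitrary commutative ring

module GeneratingFunction {c ℓ} (R : CommutativeRing c ℓ) (x : CommutativeRing.Carrier R)
  {k ℓ′} {Υ : Pred (Array 2 k) ℓ′} (Υ? : Decidable Υ) where

  open CommutativeRing R renaming (refl to ≈-refl; sym to ≈-sym; trans to ≈-trans;
    _+_ to infixl 6 _⊕_; _*_ to infixl 7 _⊛_; _-_ to infixl 6 _⊖_; -_ to neg) hiding (zero)
  open RawSemiringDefs (RawRing.rawSemiring rawRing) using (_^_)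
  open Series rawRing using (∑; _≈ₛ_÷_; 1ₛ; _-ₛ_)
  open FiniteSums R using (∑-cong)
  open ParitySeries R
  open Weights R x Υ?
  open import Algebra.Properties.Semiring.Mult semiring using () renaming (_×_ to _·_)
  open import Relation.Binary.Reasoning.Setoid setoid

  -- ι is the canonical map from ℕ, and 1/! provides reciprocals of
  -- factorials.
  module _ (ι 1/! : ℕ → Carrier) (ι≈ : ∀ m → ι m ≈ m · 1#)
    (!*1/! : ∀ m → ((m !) · 1#) ⊛ 1/! m ≈ 1#) where

    private
      y : Carrier
      y = x ⊖ 1#

      odd blocks : ℕ → Carrier
      odd    = oddSum 1/! !*1/!
      blocks = fullSum 1/! !*1/!

    -- The coefficients of t ^ (2 n - 1) on the left hand side and in the
    -- numerator, and of t ^ (2 n) in the denominator.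
    oddTerm numeratorTerm denominatorTerm : ℕ → Carrier
    oddTerm         n = 1/! (k * (2 * n ∸ 1)) ⊛ ∑ (𝓕⁽²⁾ Υ? (2 * n ∸ 1)) (λ F → x ^ mch⁽²⁾ Υ? F)
    numeratorTerm   n = y ^ (n ∸ 1) ⊛ 1/! (k * (2 * n ∸ 1)) ⊛ ι (full Υ? (2 * n ∸ 1))
    denominatorTerm n = y ^ (n ∸ 1) ⊛ 1/! (2 * k * n) ⊛ ι (full Υ? (2 * n))

    private
      full-term : ∀ r N → r ⊛ 1/! (k * suc N) ⊛ ι (full Υ? (suc N)) ≈ r ⊛ blocks (suc N)
      full-term r N = ≈-trans (*-congˡ (≈-trans (ι≈ (full Υ? (suc N))) (full≈∑ N))) (*-assoc _ _ _)

      oddTerm≈ : ∀ n → oddTerm (suc n) ≈ odd (suc (2 * n))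
      oddTerm≈ n = begin
        oddTerm (suc n)
          ≡⟨ cong (λ N → 1/! (k * N) ⊛ ∑ (𝓕⁽²⁾ Υ? N) (λ F → x ^ mch⁽²⁾ Υ? F)) (2*suc-∸1 n) ⟩
        1/! (k * suc (2 * n)) ⊛ ∑ (𝓕⁽²⁾ Υ? (suc (2 * n))) (λ F → x ^ mch⁽²⁾ Υ? F)
          ≈⟨ *-congˡ (∑-𝓕⁽²⁾ (2 * n)) ⟩
        odd (suc (2 * n)) ∎

      numeratorTerm≈ : ∀ n → numeratorTerm (suc n) ≈ y ^ n ⊛ blocks (suc (2 * n))
      numeratorTerm≈ n = begin
        numeratorTerm (suc n)
          ≡⟨ cong (λ N → y ^ n ⊛ 1/! (k * N) ⊛ ι (full Υ? N)) (2*suc-∸1 n) ⟩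
        y ^ n ⊛ 1/! (k * suc (2 * n)) ⊛ ι (full Υ? (suc (2 * n)))
          ≈⟨ full-term (y ^ n) (2 * n) ⟩
        y ^ n ⊛ blocks (suc (2 * n)) ∎

      denominatorTerm≈ : ∀ i → denominatorTerm (suc i) ≈ y ^ i ⊛ blocks (2 * suc i)
      denominatorTerm≈ i = begin
        denominatorTerm (suc i)
          ≡⟨ cong (λ N → y ^ i ⊛ 1/! N ⊛ ι (full Υ? (2 * suc i)))
               (trans (cong (_* suc i) (ℕ.*-comm 2 k)) (ℕ.*-assoc k 2 (suc i))) ⟩
        y ^ i ⊛ 1/! (k * (2 * suc i)) ⊛ ι (full Υ? (2 * suc i))
          ≈⟨ full-term (y ^ i) (i + suc (i + 0)) ⟩
        y ^ i ⊛ blocks (2 * suc i) ∎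

    oddTerm-recurrence : ∀ n → oddTerm (suc n) ≈ numeratorTerm (suc n) ⊕
      ∑ (upTo n) (λ i → denominatorTerm (suc i) ⊛ oddTerm (suc (n ∸ suc i)))
    oddTerm-recurrence n = begin
      oddTerm (suc n)
        ≈⟨ oddTerm≈ n ⟩
      odd (suc (2 * n))
        ≈⟨ oddSum-recurrence 1/! !*1/! n ⟩
      y ^ n ⊛ blocks (suc (2 * n)) ⊕ ∑ (upTo n) (λ i → y ^ i ⊛ blocks (2 * suc i) ⊛ odd (suc (2 * (n ∸ suc i))))
        ≈⟨ +-cong (numeratorTerm≈ n) (∑-cong (upTo n) (λ {i} _ →
             *-cong (denominatorTerm≈ i) (oddTerm≈ (n ∸ suc i)))) ⟨
      numeratorTerm (suc n) ⊕ ∑ (upTo n) (λ i → denominatorTerm (suc i) ⊛ oddTerm (suc (n ∸ suc i))) ∎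

    generatingFunction : oddSeries oddTerm ≈ₛ oddSeries numeratorTerm ÷ (1ₛ -ₛ evenSeries denominatorTerm)
    generatingFunction = recurrence⇒÷ oddTerm numeratorTerm denominatorTerm oddTerm-recurrence

------------------------------------------------------------------------
-- The generating function over ℚ[x]

open import Defs

theorem8 : ∀ {ℓ} (k : ℕ) → 1 ≤ k →
    (Υ : Pred (Array 2 k) ℓ) (Υ? : Decidable Υ) → Υ ⊆ IsFilling →
    (∑ₙ≥₁ λ n →
    (1/[ k * (2 * n ∸ 1) !] *ₚ (∑[ F ∈ 𝓕⁽²⁾ Υ? (2 * n ∸ 1) ] x ^ₚ mch⁽²⁾ Υ? F))
    ·t^ (2 * n ∸ 1))
    ≈ₛ
    (∑ₙ≥₁ λ n →
    ((x -ₚ 1ₚ) ^ₚ (n ∸ 1) *ₚ 1/[ k * (2 * n ∸ 1) !] *ₚ fromℕ (full Υ? (2 * n ∸ 1)))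
    ·t^ (2 * n ∸ 1))
    ÷
    (1ₛ -ₛ (∑ₙ≥₁ λ n →
    ((x -ₚ 1ₚ) ^ₚ (n ∸ 1) *ₚ 1/[ 2 * k * n !] *ₚ fromℕ (full Υ? (2 * n)))
    ·t^ (2 * n)))
theorem8 k _ Υ Υ? _ =
  GeneratingFunction.generatingFunction ℚ[x]-commutativeRing x Υ? fromℕ 1/[_!] fromℕ≈· !*1/!
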